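{- Let $N,M$ be finite sets with $z\in M$, $L:=M\setminus z\subset N$ and $N\setminus L=\{x,y\}$, where $x\ne y$. Let $r\in\mathbb{R}^{\mathcal{P}(M)}$ and let $T_{\downarrow\downarrow}(r)\in\mathbb{R}^{\mathcal{P}(N)}$ be its lower replication. (i) One has $m=T_{\downarrow\downarrow}(r)\in\mathcal{K}(N)$ if and only if [$r\in\mathcal{K}(M)$ and $r(z)\ge r(\emptyset)$]. The independency model induced by $m$ is then determined as follows: given $\langle a,b|C\rangle\in\mathcal{E}(N)$, the statement $a\perp b\mid C\ [m]$ is equivalent to - $a\cap L\perp b\cap L\mid C\cap L\ [r]$, in case $\{x,y\}\setminus(a\cup b\cup C)\ne\emptyset$; - $a\perp b\mid z\cup(C\cap L)\ [r]$, in case $\{x,y\}\subseteq C$; - $z\perp\{a,b\}\cap L\mid C\cap L\ [r]$, in case $|\{x,y\}\cap C|=1$ and $\{x,y\}\subseteq a\cup b\cup C$; - $r(z\cup C)=r(C)$, in case $\{x,y\}=\{a,b\}$. (ii) If $r\in\mathcal{K}_\ell(M)$ then $T_{\downarrow\downarrow}(r)\in\mathcal{K}_\ell(N)$. A function $r\in\mathcal{K}_\ell(M)$ is extreme in $\mathcal{K}(M)$ if and only if $T_{\downarrow\downarrow}(r)$ is extreme in $\mathcal{K}(N)$. (iii) If $r$ is extreme in $\mathcal{K}(M)$ and $r(z)=r(\emptyset)$ then $T_{\downarrow\downarrow}(r)$ is extreme in $\mathcal{K}(N)$ and, moreover, $T_{\downarrow\downarrow}(r)\approx T_{\downarrow\downarrow}(r_\ell)$.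 Conversely, if $T_{\downarrow\downarrow}(r)$ is extreme in $\mathcal{K}(N)$ then either [$r$ is extreme in $\mathcal{K}(M)$ and $r(z)=r(\emptyset)$] or one has $r(z)>r(\emptyset)$, $r\in\mathcal{L}(M)$ and $T_{\downarrow\downarrow}(r)\approx[r(z)-r(\emptyset)]\cdot m^{\{x,y\}\subseteq}$.
   Context: $\mathcal{P}(N)$ is the power set of $N$; a singleton $\{a\}$ is written $a$ (so for $a\in N$, $a\cap L$ means $\{a\}\cap L$). $\mathbb{R}^{\mathcal{P}(N)}$ is the space of functions $m:\mathcal{P}(N)\to\mathbb{R}$ with scalar product $\langle m,u\rangle=\sum_{A\subseteq N}m(A)u(A)$. A function $m$ is supermodular if $m(A)+m(B)\le m(A\cup B)+m(A\cap B)$ for all $A,B\subseteq N$, modular if equality always holds; $\mathcal{K}(N)$, $\mathcal{L}(N)$ are the classes of supermodular and modular functions. For $m^1,m^2\in\mathbb{R}^{\mathcal{P}(N)}$, $m^1\approx m^2$ (quantitative equivalence) means $m^1-m^2\in\mathcal{L}(N)$. For $A\subseteq N$, $m^{A\subseteq}(S)=1$ if $A\subseteq S$ and $0$ otherwise. $\mathcal{E}(N)$ is the set of triplets $\langle a,b|C\rangle$ with $a,b\in N$ distinct and $C\subseteq N\setminus\{a,b\}$. For $m\in\mathbb{R}^{\mathcal{P}(N)}$ and pairwise disjoint $A,B,C\subseteq N$, $A\perp B\mid C\ [m]$ means $m(A\cup B\cup C)+m(C)-m(A\cup C)-m(B\cup C)=0$ (trivially true if $A$ or $B$ is empty). The independency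 model induced by $m\in\mathcal{K}(N)$ is the set of $\langle a,b|C\rangle\in\mathcal{E}(N)$ with $a\perp b\mid C\ [m]$. A face of a convex cone $K\subseteq\mathbb{R}^{\mathcal{P}(N)}$ is a set $\{m\in K: k=\langle m,v\rangle\}$, where $v\in\mathbb{R}^{\mathcal{P}(N)}$, $k\in\mathbb{R}$ satisfy $k\le\langle m,v\rangle$ for all $m\in K$. The non-empty faces of $\mathcal{K}(N)$ form a lattice under inclusion with least element $\mathcal{L}(N)$. A function is extreme in $\mathcal{K}(N)$ if it belongs to $\mathcal{K}(N)$ and the smallest face of $\mathcal{K}(N)$ containing it is an atom of this lattice. $\mathcal{K}_\ell(N)=\{m\in\mathcal{K}(N): m(\emptyset)=0,\ m(i)=0\ \forall i\in N\}$, and for $m\in\mathbb{R}^{\mathcal{P}(N)}$ the lower standardization is $m_\ell(T)=m(T)-m(\emptyset)+\sum_{i\in T}[m(\emptyset)-m(i)]$ for $T\subseteq N$. All these definitions are used for other finite sets in place of $N$. The lower replication $T_{\downarrow\downarrow}:\mathbb{R}^{\mathcal{P}(M)}\to\mathbb{R}^{\mathcal{P}(N)}$ is defined, for $S\subseteq N$, by $[T_{\downarrow\downarrow}(r)](S)=r(z\cup(S\cap L))$ if $N\setminus L\subseteq S$, and $[T_{\downarrow\downarrow}(r)](S)=r(S\cap L)$ otherwise. -}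

module Defs where

open import Level using (0ℓ) renaming (suc to lsuc)
open import Algebra.Bundles using (CommutativeRing)
open import Data.Bool.Base using (if_then_else_)
open import Data.Nat.Base using (ℕ)
open import Data.Fin.Base using (Fin)
open import Data.Fin.Subset renaming (⊥ to ∅) hiding (_-_)
open import Data.Fin.Subset.Properties using (_∈?_; _⊆?_)
open import Data.Product.Base using (∃; _×_)
open import Data.Sum.Base using (_⊎_)
open import Data.Vec.Base using ([]; _∷_)
open import Function.Base using (_∘_)
open import Relation.Binary.Core using (Rel)
open import Relation.Binary.Structures using (IsDecTotalOrder)
open import Relation.Binary.PropositionalEquality.Core using (_≢_)
open import Relation.Nullary.Decidable.Core using (does)
open import Relation.Nullary.Negation.Core using (¬_)
open import Relation.Unary as Pred using (Pred; _≐_)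
import Algebra.Properties.CommutativeMonoid.Sum as Sum
import Relation.Binary.Construct.NonStrictToStrict as ToStrict

-- The real numbers, axiomatised as a Dedekind-complete totally ordered field;
-- classically this determines ℝ up to a unique isomorphism.  The order is
-- decidable because trichotomy of the reals is used as in classical mathematics.
record RealNumbers : Set (lsuc 0ℓ) where
  field
    commutativeRing : CommutativeRing 0ℓ 0ℓ

  open CommutativeRing commutativeRing public

  infix 4 _≤_
  field
    _≤_             : Rel Carrier 0ℓ
    isDecTotalOrder : IsDecTotalOrder _≈_ _≤_
    0≉1             : ¬ (0# ≈ 1#)
    inverse         : ∀ x → ¬ (x ≈ 0#) → ∃ λ y → x * y ≈ 1#
    +-monoˡ-≤       : ∀ {x y} z → x ≤ y → x + z ≤ y + z
    *-nonneg        : ∀ {x y} → 0# ≤ x → 0# ≤ y → 0# ≤ x * y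

  IsUpperBound : Pred Carrier 0ℓ → Carrier → Set
  IsUpperBound P u = ∀ x → P x → x ≤ u

  field
    supremum : (P : Pred Carrier 0ℓ) → ∃ P → ∃ (IsUpperBound P) →
               ∃ λ s → IsUpperBound P s × (∀ u → IsUpperBound P u → s ≤ u)

  open ToStrict _≈_ _≤_ public using (_<_)

-- Finite sets are subsets of an ambient finite set Fin n, so that N and M may
-- overlap.
module SetFunctions (ℝ : RealNumbers) where

  open RealNumbers ℝ public using (Carrier; _≈_; _≤_; _<_; _+_; _*_; _-_; 0#; 1#)
  open RealNumbers ℝ using (+-commutativeMonoid)
  open Sum +-commutativeMonoid using (sum)

  private
    variable
      n : ℕ

  -- An element m of ℝ^𝒫(N) is represented by a function on all subsets of
  -- Fin n.  Every notion below that carries the parameter N depends only on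
  -- the values m(A) with A ⊆ N; the other values are irrelevant.
  SetFunction : ℕ → Set
  SetFunction n = Subset n → Carrier

  -- ∑⊆ N f is the sum of f(A) over all A ⊆ N.
  ∑⊆ : Subset n → SetFunction n → Carrier
  ∑⊆ []            f = f []
  ∑⊆ (outside ∷ N) f = ∑⊆ N (f ∘ (outside ∷_))
  ∑⊆ (inside  ∷ N) f = ∑⊆ N (f ∘ (outside ∷_)) + ∑⊆ N (f ∘ (inside ∷_))

  scalarProduct : Subset n → SetFunction n → SetFunction n → Carrier
  scalarProduct N m u = ∑⊆ N λ A → m A * u A

  𝓚 : Subset n → Pred (SetFunction n) 0ℓ
  𝓚 N m = ∀ A B → A ⊆ N → B ⊆ N → m A + m B ≤ m (A ∪ B) + m (A ∩ B)

  𝓛 : Subset n → Pred (SetFunction n) 0ℓ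
  𝓛 N m = ∀ A B → A ⊆ N → B ⊆ N → m A + m B ≈ m (A ∪ B) + m (A ∩ B)

  𝓚ℓ : Subset n → Pred (SetFunction n) 0ℓ
  𝓚ℓ N m = 𝓚 N m × m ∅ ≈ 0# × (∀ i → i ∈ N → m ⁅ i ⁆ ≈ 0#)

  QuantEquiv : Subset n → SetFunction n → SetFunction n → Set
  QuantEquiv N m¹ m² = 𝓛 N λ S → m¹ S - m² S

  indicator⊇ : Subset n → SetFunction n
  indicator⊇ A S = if does (A ⊆? S) then 1# else 0#

  lowerStd : SetFunction n → SetFunction n
  lowerStd m T =
    (m T - m ∅) + sum λ i → if does (i ∈? T) then m ∅ - m ⁅ i ⁆ else 0#

  -- The triplet ⟨a,b|C⟩ belongs to ℰ(N).
  ElementaryTriplet : Subset n → Fin n → Fin n → Subset n → Set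
  ElementaryTriplet N a b C =
    a ∈ N × b ∈ N × a ≢ b × C ⊆ N ─ (⁅ a ⁆ ∪ ⁅ b ⁆)

  -- A ⊥ B ∣ C [m], used for pairwise disjoint A, B, C only.
  Indep : SetFunction n → Subset n → Subset n → Subset n → Set
  Indep m A B C = ((m (A ∪ B ∪ C) + m C) - m (A ∪ C)) - m (B ∪ C) ≈ 0#

  record Face (N : Subset n) (K : Pred (SetFunction n) 0ℓ) : Set where
    field
      v     : SetFunction n
      k     : Carrier
      valid : ∀ m → K m → k ≤ scalarProduct N m v

    members : Pred (SetFunction n) 0ℓ
    members m = K m × k ≈ scalarProduct N m v

  open Face public using (members)

  -- F is an atom of the lattice of non-empty faces of 𝓚(N), whose least
  -- element is 𝓛(N).
  IsAtom : (N : Subset n) → Face N (𝓚 N) → Set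
  IsAtom N F =
    ∃ (members F) ×
    ¬ (members F ≐ 𝓛 N) ×
    ((G : Face N (𝓚 N)) → ∃ (members G) → members G Pred.⊆ members F →
     (members G ≐ 𝓛 N) ⊎ (members G ≐ members F))

  IsSmallestFaceContaining :
    (N : Subset n) → SetFunction n → Face N (𝓚 N) → Set
  IsSmallestFaceContaining N m F =
    members F m ×
    ((G : Face N (𝓚 N)) → members G m → members F Pred.⊆ members G)

  Extreme : Subset n → Pred (SetFunction n) 0ℓ
  Extreme N m =
    𝓚 N m × ∃ λ F → IsSmallestFaceContaining N m F × IsAtom N F

  -- The lower replication T↓↓, with L = M ∖ z.
  lowerRep : (N L : Subset n) → Fin n → SetFunction n → SetFunction n
  lowerRep N L z r S =
    if does ((N ─ L) ⊆? S) then r (⁅ z ⁆ ∪ (S ∩ L)) else r (S ∩ L)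

{-# OPTIONS --safe #-}

-- Write Δ m A B = m(A∪B) + m(A∩B) − m(A) − m(B).  A supermodular m is extreme
-- iff it is not modular and every supermodular function satisfying the
-- equalities Δ = 0 of m is modular or satisfies no further ones: the functions
-- satisfying the equalities of m form the smallest face containing m.
-- A replication m = r ∘ contract satisfies Δ m A B = Δ r (contract A) (contract B),
-- except when {x,y} is contained in A ∪ B but in neither A nor B; then
--   Δ m A B = Δ r (z∪a) b + Δ r z a + (r(z) − r(∅)),   a = A∩L, b = B∩L.
-- Hence the equalities of a supermodular m encode those of r and whether
-- r(z) = r(∅), and extremality moves between r and m once modular functions
-- are subtracted.

module Submission where

open import Defs
open import Data.Fin.Base using (Fin)
open import Data.Fin.Subset renaming (⊥ to ∅) hiding (_-_)
open import Data.Nat.Base using (ℕ)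
open import Data.Product.Base using (_×_)
open import Data.Sum.Base using (_⊎_)
open import Function.Bundles using (_⇔_)
open import Relation.Binary.PropositionalEquality.Core using (_≡_; _≢_)

open import Level using (0ℓ)
open import Algebra.Bundles using (CommutativeRing)
open import Algebra.Solver.Ring.AlmostCommutativeRing
  using (fromCommutativeRing; _-Raw-AlmostCommutative⟶_)
open import Data.Bool.Base using (Bool; true; false; T; not; _∧_; _∨_; if_then_else_)
open import Data.Bool.Properties using (T-≡; T-∧; if-float)
open import Data.Empty using (⊥-elim)
open import Data.Fin.Base using (zero; suc)
import Data.Fin.Properties as Fin
open import Data.Fin.Subset.Properties
open import Data.Integer.Base as ℤ using (ℤ; +_; -[1+_]; _⊖_)
import Data.Integer.Properties as ℤ
open import Data.List.Base as List using (List; []; _∷_)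
import Data.Maybe.Base as Maybe
open import Data.Nat.Base as ℕ using (zero; suc)
import Data.Nat.Properties as ℕ
open import Data.Product.Base using (_,_; proj₁; proj₂; ∃)
open import Data.Sum.Base as Sum using (inj₁; inj₂)
open import Data.Unit.Base using (tt)
open import Data.Vec.Base as Vec using (Vec; []; _∷_; lookup)
open import Data.Vec.Properties
  using (lookup-zipWith; lookup-replicate; lookup-map; []=⇒lookup; lookup⇒[]=)
open import Function.Base using (_∘_; id)
open import Function.Bundles using (Equivalence; mk⇔)
open import Relation.Binary.Consequences using (dec⇒weaklyDec)
import Relation.Binary.PropositionalEquality.Core as ≡
open import Relation.Binary.Structures using (IsDecTotalOrder)
open import Relation.Nullary using (¬_; Dec; does; yes; no; contradiction)
open import Relation.Unary as Pred using (Pred; _≐_)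

-- The description of the smallest face rests on finiteness. There are finitely many pairs of sets,
-- so the tight inequalities of `m` add up to one functional, and `m` minus a small multiple of a
-- supermodular `m′` satisfying the equalities of `m` stays in the cone. A functional that is
-- nonnegative on the cone and zero at `m` must therefore vanish at `m′`. The obstacle to moving
-- extremality is that competitors need not match. A competitor of a replication is an arbitrary
-- supermodular function on N; but sets missing x or y yield equalities shared by all replications,
-- and these force the competitor to be a replication up to a modular function. Conversely, a
-- competitor `r′` on M may have r′(z) < r′(∅), so that its replication leaves the cone; a modular
-- correction at z first makes the two values equal.

-- Normalisation of ring identities

module IntegerCoefficients {c ℓ} (R : CommutativeRing c ℓ) where
  open CommutativeRing R hiding (zero)
  open import Algebra.Properties.Ring ring
    using (-‿distribˡ-*; -‿distribʳ-*; -0#≈0#; -‿involutive; -‿+-comm)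
  open import Algebra.Properties.Semiring.Mult semiring
    using (×-homo-+; ×1-homo-*) renaming (_×_ to infixr 8 _·_)
  open import Relation.Binary.Reasoning.Setoid setoid

  ⟦_⟧ℤ : ℤ → Carrier
  ⟦ + n      ⟧ℤ = n · 1#
  ⟦ -[1+ n ] ⟧ℤ = - (suc n · 1#)

  -‿homo : ∀ i → ⟦ ℤ.- i ⟧ℤ ≈ - ⟦ i ⟧ℤ
  -‿homo (+ zero)   = sym -0#≈0#
  -‿homo (+ suc n)  = refl
  -‿homo (-[1+ n ]) = sym (-‿involutive _)

  suc-minus-suc : ∀ a b → a - b ≈ (1# + a) - (1# + b)
  suc-minus-suc a b = begin
    a - b                    ≈⟨ +-identityˡ _ ⟨
    0# + (a - b)             ≈⟨ +-congʳ (-‿inverseʳ 1#) ⟨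
    (1# - 1#) + (a - b)      ≈⟨ +-assoc _ _ _ ⟩
    1# + (- 1# + (a - b))    ≈⟨ +-congˡ (+-assoc _ _ _) ⟨
    1# + ((- 1# + a) - b)    ≈⟨ +-congˡ (+-congʳ (+-comm _ _)) ⟩
    1# + ((a - 1#) - b)      ≈⟨ +-congˡ (+-assoc _ _ _) ⟩
    1# + (a + (- 1# - b))    ≈⟨ +-assoc _ _ _ ⟨
    (1# + a) + (- 1# - b)    ≈⟨ +-congˡ (-‿+-comm 1# b) ⟩
    (1# + a) - (1# + b)      ∎

  ⊖-homo : ∀ m n → ⟦ m ⊖ n ⟧ℤ ≈ m · 1# - n · 1#
  ⊖-homo m       zero    = sym (trans (+-congˡ -0#≈0#) (+-identityʳ _))
  ⊖-homo zero    (suc n) = sym (+-identityˡ _)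
  ⊖-homo (suc m) (suc n) = begin
    ⟦ suc m ⊖ suc n ⟧ℤ       ≡⟨ ≡.cong ⟦_⟧ℤ (ℤ.[1+m]⊖[1+n]≡m⊖n m n) ⟩
    ⟦ m ⊖ n ⟧ℤ               ≈⟨ ⊖-homo m n ⟩
    m · 1# - n · 1#          ≈⟨ suc-minus-suc _ _ ⟩
    suc m · 1# - suc n · 1#  ∎

  +-homo : ∀ i j → ⟦ i ℤ.+ j ⟧ℤ ≈ ⟦ i ⟧ℤ + ⟦ j ⟧ℤ
  +-homo (+ m)      (+ n)      = ×-homo-+ 1# m n
  +-homo (+ m)      (-[1+ n ]) = ⊖-homo m (suc n)
  +-homo (-[1+ m ]) (+ n)      = trans (⊖-homo n (suc m)) (+-comm _ _)
  +-homo (-[1+ m ]) (-[1+ n ]) = begin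
    - (1# + (1# + (m ℕ.+ n) · 1#))       ≈⟨ -‿cong (+-congˡ (+-congˡ (×-homo-+ 1# m n))) ⟩
    - (1# + (1# + (m · 1# + n · 1#)))    ≈⟨ -‿cong (+-congˡ (+-assoc _ _ _)) ⟨
    - (1# + (suc m · 1# + n · 1#))       ≈⟨ -‿cong (+-congˡ (+-comm _ _)) ⟩
    - (1# + (n · 1# + suc m · 1#))       ≈⟨ -‿cong (+-assoc _ _ _) ⟨
    - (suc n · 1# + suc m · 1#)          ≈⟨ -‿cong (+-comm _ _) ⟩
    - (suc m · 1# + suc n · 1#)          ≈⟨ -‿+-comm _ _ ⟨
    - (suc m · 1#) - suc n · 1#          ∎

  *-homo-pos : ∀ m j → ⟦ + m ℤ.* j ⟧ℤ ≈ m · 1# * ⟦ j ⟧ℤ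
  *-homo-pos m (+ n) = begin
    ⟦ + m ℤ.* + n ⟧ℤ   ≡⟨ ≡.cong ⟦_⟧ℤ (ℤ.pos-* m n) ⟨
    (m ℕ.* n) · 1#     ≈⟨ ×1-homo-* m n ⟩
    m · 1# * n · 1#    ∎
  *-homo-pos m (-[1+ n ]) = begin
    ⟦ + m ℤ.* -[1+ n ] ⟧ℤ         ≡⟨ ≡.cong ⟦_⟧ℤ (ℤ.neg-distribʳ-* (+ m) (+ suc n)) ⟨
    ⟦ ℤ.- (+ m ℤ.* + suc n) ⟧ℤ    ≈⟨ -‿homo (+ m ℤ.* + suc n) ⟩
    - ⟦ + m ℤ.* + suc n ⟧ℤ        ≈⟨ -‿cong (*-homo-pos m (+ suc n)) ⟩
    - (m · 1# * suc n · 1#)       ≈⟨ -‿distribʳ-* _ _ ⟩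
    m · 1# * - (suc n · 1#)       ∎

  *-homo : ∀ i j → ⟦ i ℤ.* j ⟧ℤ ≈ ⟦ i ⟧ℤ * ⟦ j ⟧ℤ
  *-homo (+ m)      j = *-homo-pos m j
  *-homo (-[1+ m ]) j = begin
    ⟦ -[1+ m ] ℤ.* j ⟧ℤ           ≡⟨ ≡.cong ⟦_⟧ℤ (ℤ.neg-distribˡ-* (+ suc m) j) ⟨
    ⟦ ℤ.- (+ suc m ℤ.* j) ⟧ℤ      ≈⟨ -‿homo (+ suc m ℤ.* j) ⟩
    - ⟦ + suc m ℤ.* j ⟧ℤ          ≈⟨ -‿cong (*-homo-pos (suc m) j) ⟩
    - (suc m · 1# * ⟦ j ⟧ℤ)       ≈⟨ -‿distribˡ-* _ _ ⟩
    - (suc m · 1#) * ⟦ j ⟧ℤ       ∎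

  -- Equality in an abstract ring does not compute. Integer coefficients map to every commutative
  -- ring and their equality does compute, so cancellations happen during normalisation.
  morphism : ℤ.+-*-rawRing -Raw-AlmostCommutative⟶ fromCommutativeRing R
  morphism = record
    { ⟦_⟧    = ⟦_⟧ℤ
    ; +-homo = +-homo
    ; *-homo = *-homo
    ; -‿homo = -‿homo
    ; 0-homo = refl
    ; 1-homo = +-identityʳ 1#
    }

  open import Algebra.Solver.Ring ℤ.+-*-rawRing (fromCommutativeRing R) morphism
    (λ i j → Maybe.map (λ eq → reflexive (≡.cong ⟦_⟧ℤ eq)) (dec⇒weaklyDec ℤ._≟_ i j))
    public using (solve; _:=_; _:+_; _:*_; _:-_; :-_)

-- An inclusion between Boolean combinations of sets follows from other such
-- inclusions once it does so pointwise, which is a finite check.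
module SetSolver where

  infixr 9 _:∩_
  infixr 8 _:∪_
  infixl 7 _:─_
  infix  6 _:⊆_

  data Term (k : ℕ) : Set where
    var             : Fin k → Term k
    :∅              : Term k
    _:∪_ _:∩_ _:─_  : (s t : Term k) → Term k

  record Inclusion (k : ℕ) : Set where
    constructor _:⊆_
    field
      lhs rhs : Term k

  private
    variable
      k n : ℕ

  ⟦_⟧ : Term k → Vec (Subset n) k → Subset n
  ⟦ var i  ⟧ ρ = lookup ρ i
  ⟦ :∅     ⟧ ρ = ∅
  ⟦ s :∪ t ⟧ ρ = ⟦ s ⟧ ρ ∪ ⟦ t ⟧ ρ
  ⟦ s :∩ t ⟧ ρ = ⟦ s ⟧ ρ ∩ ⟦ t ⟧ ρ
  ⟦ s :─ t ⟧ ρ = ⟦ s ⟧ ρ ─ ⟦ t ⟧ ρ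

  Holds : Vec (Subset n) k → Inclusion k → Set
  Holds ρ (s :⊆ t) = ⟦ s ⟧ ρ ⊆ ⟦ t ⟧ ρ

  ⟦_⟧ᵇ : Term k → Vec Bool k → Bool
  ⟦ var i  ⟧ᵇ β = lookup β i
  ⟦ :∅     ⟧ᵇ β = false
  ⟦ s :∪ t ⟧ᵇ β = ⟦ s ⟧ᵇ β ∨ ⟦ t ⟧ᵇ β
  ⟦ s :∩ t ⟧ᵇ β = ⟦ s ⟧ᵇ β ∧ ⟦ t ⟧ᵇ β
  ⟦ s :─ t ⟧ᵇ β = ⟦ s ⟧ᵇ β ∧ not (⟦ t ⟧ᵇ β)

  at : Fin n → Vec (Subset n) k → Vec Bool k
  at i = Vec.map λ S → lookup S i

  lookup-─ : ∀ (p q : Subset n) i → lookup (p ─ q) i ≡ lookup p i ∧ not (lookup q i)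
  lookup-─ (false ∷ p) (true  ∷ q) zero    = ≡.refl
  lookup-─ (false ∷ p) (false ∷ q) zero    = ≡.refl
  lookup-─ (true  ∷ p) (true  ∷ q) zero    = ≡.refl
  lookup-─ (true  ∷ p) (false ∷ q) zero    = ≡.refl
  lookup-─ (_ ∷ p)     (_ ∷ q)     (suc i) = lookup-─ p q i

  lookup-⟦⟧ : ∀ (t : Term k) (ρ : Vec (Subset n) k) i → lookup (⟦ t ⟧ ρ) i ≡ ⟦ t ⟧ᵇ (at i ρ)
  lookup-⟦⟧ (var j)  ρ i = ≡.sym (lookup-map j (λ S → lookup S i) ρ)
  lookup-⟦⟧ :∅       ρ i = lookup-replicate i outside
  lookup-⟦⟧ (s :∪ t) ρ i = ≡.trans (lookup-zipWith _∨_ i (⟦ s ⟧ ρ) (⟦ t ⟧ ρ))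
    (≡.cong₂ _∨_ (lookup-⟦⟧ s ρ i) (lookup-⟦⟧ t ρ i))
  lookup-⟦⟧ (s :∩ t) ρ i = ≡.trans (lookup-zipWith _∧_ i (⟦ s ⟧ ρ) (⟦ t ⟧ ρ))
    (≡.cong₂ _∧_ (lookup-⟦⟧ s ρ i) (lookup-⟦⟧ t ρ i))
  lookup-⟦⟧ (s :─ t) ρ i = ≡.trans (lookup-─ (⟦ s ⟧ ρ) (⟦ t ⟧ ρ) i)
    (≡.cong₂ (λ a b → a ∧ not b) (lookup-⟦⟧ s ρ i) (lookup-⟦⟧ t ρ i))

  everywhere : ∀ k → (Vec Bool k → Bool) → Bool
  everywhere zero    P = P []
  everywhere (suc k) P = everywhere k (λ β → P (false ∷ β)) ∧ everywhere k (λ β → P (true ∷ β))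

  everywhere-sound : ∀ k P → T (everywhere k P) → ∀ β → T (P β)
  everywhere-sound zero    P h []          = h
  everywhere-sound (suc k) P h (false ∷ β) =
    everywhere-sound k _ (proj₁ (Equivalence.to T-∧ h)) β
  everywhere-sound (suc k) P h (true ∷ β)  =
    everywhere-sound k _ (proj₂ (Equivalence.to T-∧ h)) β

  infixr 4 _⇒ᵇ_
  _⇒ᵇ_ : Bool → Bool → Bool
  a ⇒ᵇ b = if a then b else true

  holdsᵇ : Inclusion k → Vec Bool k → Bool
  holdsᵇ (s :⊆ t) β = ⟦ s ⟧ᵇ β ⇒ᵇ ⟦ t ⟧ᵇ β

  follows : List (Inclusion k) → Inclusion k → Vec Bool k → Bool
  follows []       c β = holdsᵇ c β
  follows (h ∷ hs) c β = holdsᵇ h β ⇒ᵇ follows hs c β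

  modus-ponens : ∀ a b → T (a ⇒ᵇ b) → T a → T b
  modus-ponens true b h _ = h

  deduction : ∀ a b → (T a → T b) → T (a ⇒ᵇ b)
  deduction true  b f = f tt
  deduction false b f = tt

  ∈⇒T : ∀ (t : Term k) (ρ : Vec (Subset n) k) {i} → i ∈ ⟦ t ⟧ ρ → T (⟦ t ⟧ᵇ (at i ρ))
  ∈⇒T t ρ {i} i∈ = Equivalence.from T-≡ (≡.trans (≡.sym (lookup-⟦⟧ t ρ i)) ([]=⇒lookup i∈))

  T⇒∈ : ∀ (t : Term k) (ρ : Vec (Subset n) k) {i} → T (⟦ t ⟧ᵇ (at i ρ)) → i ∈ ⟦ t ⟧ ρ
  T⇒∈ t ρ {i} h = lookup⇒[]= i _ (≡.trans (lookup-⟦⟧ t ρ i) (Equivalence.to T-≡ h))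

  Fact : Vec (Subset n) k → Set
  Fact ρ = ∃ (Holds ρ)

  -- Everything takes place at the single point `i`: a fact `a ⊆ b` yields there the implication
  -- between the truth values of `a` and `b`, which discharges one premise of `follows`.
  follows-sound : (ρ : Vec (Subset n) k) (hs : List (Fact ρ)) (s t : Term k) {i : Fin n} →
                  T (follows (List.map proj₁ hs) (s :⊆ t) (at i ρ)) → i ∈ ⟦ s ⟧ ρ → i ∈ ⟦ t ⟧ ρ
  follows-sound ρ []                    s t h i∈s =
    T⇒∈ t ρ (modus-ponens _ _ h (∈⇒T s ρ i∈s))
  follows-sound ρ ((a :⊆ b , a⊆b) ∷ hs) s t h i∈s =
    follows-sound ρ hs s t
      (modus-ponens _ _ h (deduction _ _ λ i∈a → ∈⇒T b ρ (a⊆b (T⇒∈ a ρ i∈a)))) i∈s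

  Valid : List (Inclusion k) → Inclusion k → Set
  Valid hs c = T (everywhere _ (follows hs c))

  -- For concrete terms `Valid` evaluates to the unit type, so its proof is inferred. Only the
  -- statements of the facts enter that evaluation; their proofs are consumed by `follows-sound`.
  prove-⊆ : (ρ : Vec (Subset n) k) (hs : List (Fact ρ)) (s t : Term k) →
            {Valid (List.map proj₁ hs) (s :⊆ t)} → ⟦ s ⟧ ρ ⊆ ⟦ t ⟧ ρ
  prove-⊆ ρ hs s t {h} {i} = follows-sound ρ hs s t
    (everywhere-sound _ (follows (List.map proj₁ hs) (s :⊆ t)) h (at i ρ))

  prove-≡ : (ρ : Vec (Subset n) k) (hs : List (Fact ρ)) (s t : Term k) →
            {Valid (List.map proj₁ hs) (s :⊆ t)} → {Valid (List.map proj₁ hs) (t :⊆ s)} →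
            ⟦ s ⟧ ρ ≡ ⟦ t ⟧ ρ
  prove-≡ ρ hs s t {h} {h′} = ⊆-antisym (prove-⊆ ρ hs s t {h}) (prove-⊆ ρ hs t s {h′})

-- Arithmetic in an ordered field

module OrderedField (ℝ : RealNumbers) where

  open RealNumbers ℝ
  open IsDecTotalOrder isDecTotalOrder public
    using (_≟_; total; antisym; ≤-respˡ-≈; ≤-respʳ-≈)
    renaming (refl to ≤-refl; trans to ≤-trans; reflexive to ≤-reflexive)
  open IntegerCoefficients commutativeRing public
    using (solve; _:=_; _:+_; _:*_; _:-_; :-_)
  open import Relation.Binary.Reasoning.Setoid setoid

  private
    variable
      a b c d x y : Carrier

  ≤-cong : a ≈ b → c ≈ d → a ≤ c → b ≤ d
  ≤-cong a≈b c≈d a≤c = ≤-respʳ-≈ c≈d (≤-respˡ-≈ a≈b a≤c)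

  ≤⇒0≤- : x ≤ y → 0# ≤ y - x
  ≤⇒0≤- {x} {y} x≤y = ≤-respˡ-≈ (-‿inverseʳ x) (+-monoˡ-≤ (- x) x≤y)

  0≤-⇒≤ : 0# ≤ y - x → x ≤ y
  0≤-⇒≤ {y} {x} h = ≤-cong (+-identityˡ x)
    (solve 2 (λ y x → y :- x :+ x := y) refl y x) (+-monoˡ-≤ x h)

  0≤-+ : 0# ≤ x → 0# ≤ y → 0# ≤ x + y
  0≤-+ {x} {y} 0≤x 0≤y =
    ≤-trans 0≤y (≤-respˡ-≈ (+-identityˡ y) (+-monoˡ-≤ y 0≤x))

  0≤-+≈0⇒≈0 : 0# ≤ x → 0# ≤ y → x + y ≈ 0# → x ≈ 0#
  0≤-+≈0⇒≈0 {x} {y} 0≤x 0≤y x+y≈0 = antisym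
    (≤-respʳ-≈ x+y≈0 (≤-cong (+-identityˡ x) (+-comm y x) (+-monoˡ-≤ x 0≤y))) 0≤x

  x-y≈0⇒x≈y : x - y ≈ 0# → x ≈ y
  x-y≈0⇒x≈y {x} {y} h = begin
    x            ≈⟨ solve 2 (λ x y → x := x :- y :+ y) refl x y ⟩
    x - y + y    ≈⟨ +-congʳ h ⟩
    0# + y       ≈⟨ +-identityˡ y ⟩
    y            ∎

  x≈y⇒x-y≈0 : x ≈ y → x - y ≈ 0#
  x≈y⇒x-y≈0 {x} {y} x≈y = trans (+-congʳ x≈y) (-‿inverseʳ y)

  *-mono-≤ : 0# ≤ c → x ≤ y → c * x ≤ c * y
  *-mono-≤ {c} {x} {y} 0≤c x≤y = 0≤-⇒≤
    (≤-respʳ-≈ (solve 3 (λ c x y → c :* (y :- x) := c :* y :- c :* x) refl c x y)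
      (*-nonneg 0≤c (≤⇒0≤- x≤y)))

  0≤1 : 0# ≤ 1#
  0≤1 with total 0# 1#
  ... | inj₁ 0≤1 = 0≤1
  ... | inj₂ 1≤0 = ≤-respʳ-≈ -1*-1≈1 (*-nonneg 0≤-1 0≤-1)
    where
    0≤-1 : 0# ≤ - 1#
    0≤-1 = ≤-respʳ-≈ (+-identityˡ _) (≤⇒0≤- 1≤0)
    -1*-1≈1 : - 1# * - 1# ≈ 1#
    -1*-1≈1 = trans (solve 1 (λ x → (:- x) :* (:- x) := x :* x) refl 1#) (*-identityˡ 1#)

  *≈0⇒≈0 : ¬ (c ≈ 0#) → c * x ≈ 0# → x ≈ 0#
  *≈0⇒≈0 {c} {x} c≉0 cx≈0 with inverse c c≉0
  ... | c⁻¹ , cc⁻¹≈1 = begin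
    x               ≈⟨ *-identityˡ x ⟨
    1# * x          ≈⟨ *-congʳ cc⁻¹≈1 ⟨
    c * c⁻¹ * x     ≈⟨ solve 3 (λ c d x → c :* d :* x := d :* (c :* x)) refl c c⁻¹ x ⟩
    c⁻¹ * (c * x)   ≈⟨ *-congˡ cx≈0 ⟩
    c⁻¹ * 0#        ≈⟨ zeroʳ c⁻¹ ⟩
    0#              ∎

  inverse-nonneg : 0# ≤ x → x * y ≈ 1# → 0# ≤ y
  inverse-nonneg {x} {y} 0≤x xy≈1 with total 0# y
  ... | inj₁ 0≤y = 0≤y
  ... | inj₂ y≤0 = contradiction (antisym 0≤1 1≤0) 0≉1
    where
    1≤0 : 1# ≤ 0#
    1≤0 = ≤-cong xy≈1 (zeroʳ x) (*-mono-≤ 0≤x y≤0)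

  Positive : Pred Carrier 0ℓ
  Positive ε = 0# ≤ ε × ¬ (ε ≈ 0#)

  1-positive : Positive 1#
  1-positive = 0≤1 , 0≉1 ∘ sym

  -- The witness is the ratio c / d, nonzero because c cannot vanish unless d does; if d = 0, any ε
  -- works, and 1 is taken. In `small-step`, c and d are the values of `Δ m` and `Δ m′` at one pair
  -- of sets.
  rescale : 0# ≤ c → 0# ≤ d → (c ≈ 0# → d ≈ 0#) → ∃ λ ε → Positive ε × ε * d ≤ c
  rescale {c} {d} 0≤c 0≤d c≈0⇒d≈0 with d ≟ 0#
  ... | yes d≈0 = 1# , 1-positive , ≤-respˡ-≈ (sym (trans (*-congˡ d≈0) (zeroʳ 1#))) 0≤c
  ... | no  d≉0 with inverse d d≉0
  ...   | d⁻¹ , dd⁻¹≈1 =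
    c * d⁻¹ , (*-nonneg 0≤c (inverse-nonneg 0≤d dd⁻¹≈1) , ε≉0) , ≤-reflexive εd≈c
    where
    εd≈c : c * d⁻¹ * d ≈ c
    εd≈c = trans (solve 3 (λ c e d → c :* e :* d := c :* (d :* e)) refl c d⁻¹ d)
      (trans (*-congˡ dd⁻¹≈1) (*-identityʳ c))
    ε≉0 : ¬ (c * d⁻¹ ≈ 0#)
    ε≉0 ε≈0 = d≉0 (c≈0⇒d≈0 (trans (sym εd≈c) (trans (*-congʳ ε≈0) (zeroˡ d))))

  -- A whole interval of values is demanded so that the notion is closed under conjunction: the
  -- smaller of two bounds serves both.
  ForSmall : Pred (Pred Carrier 0ℓ) 0ℓ
  ForSmall P = ∃ λ ε → Positive ε × (∀ δ → 0# ≤ δ → δ ≤ ε → P δ)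

  ForSmall-× : (P Q : Pred Carrier 0ℓ) → ForSmall P → ForSmall Q → ForSmall (λ δ → P δ × Q δ)
  ForSmall-× P Q (ε , ε>0 , p) (ε′ , ε′>0 , q) with total ε ε′
  ... | inj₁ ε≤ε′ = ε  , ε>0  , λ δ 0≤δ δ≤ → p δ 0≤δ δ≤ , q δ 0≤δ (≤-trans δ≤ ε≤ε′)
  ... | inj₂ ε′≤ε = ε′ , ε′>0 , λ δ 0≤δ δ≤ → p δ 0≤δ (≤-trans δ≤ ε′≤ε) , q δ 0≤δ δ≤

  ForSmall-map : (P Q : Pred Carrier 0ℓ) → (∀ δ → P δ ⇔ Q δ) → ForSmall P → ForSmall Q
  ForSmall-map P Q P⇔Q (ε , ε>0 , p) =
    ε , ε>0 , λ δ 0≤δ δ≤ → Equivalence.to (P⇔Q δ) (p δ 0≤δ δ≤)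

-- Induction for finite conjunctions: the subsets split into those without and those with the first
-- element. It serves both `Exposed` and `ForSmall`; invariance is asked only under equivalence
-- because an exposed property need not stay exposed when weakened.
∀-Subset : ∀ {X : Set} (F : Pred (Pred X 0ℓ) 0ℓ) →
           (∀ P Q → F P → F Q → F (λ x → P x × Q x)) →
           (∀ P Q → (∀ x → P x ⇔ Q x) → F P → F Q) →
           ∀ {n} (P : Subset n → Pred X 0ℓ) → (∀ A → F (P A)) → F (λ x → ∀ A → P A x)
∀-Subset F pair mono {zero} P all =
  mono (P []) _ (λ x → mk⇔ (λ { p [] → p }) (λ p → p [])) (all [])
∀-Subset F pair mono {suc n} P all =
  mono _ _
    (λ x → mk⇔ (λ { (p , q) (outside ∷ A) → p A ; (p , q) (inside ∷ A) → q A })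
               (λ p → (λ A → p (outside ∷ A)) , (λ A → p (inside ∷ A))))
    (pair _ _ (∀-Subset F pair mono (P ∘ (outside ∷_)) (all ∘ (outside ∷_)))
              (∀-Subset F pair mono (P ∘ (inside ∷_)) (all ∘ (inside ∷_))))

-- Inequalities and equalities of the supermodular cone

module SupermodularCone (ℝ : RealNumbers) where

  open RealNumbers ℝ hiding (zero)
  open SetFunctions ℝ hiding (Carrier; _≈_; _≤_; _<_; _+_; _*_; _-_; 0#; 1#)
  open OrderedField ℝ
  open import Relation.Binary.Reasoning.Setoid setoid

  private
    variable
      n : ℕ
      N A B : Subset n
      m m′ m″ : SetFunction n

  Δ : SetFunction n → Subset n → Subset n → Carrier
  Δ m A B = (m (A ∪ B) + m (A ∩ B)) - (m A + m B)

  Δ-+ : ∀ (m m′ : SetFunction n) A B → Δ (λ S → m S + m′ S) A B ≈ Δ m A B + Δ m′ A B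
  Δ-+ m m′ A B = solve 8
    (λ a b c d a′ b′ c′ d′ → (a :+ a′ :+ (b :+ b′)) :- (c :+ c′ :+ (d :+ d′)) :=
      ((a :+ b) :- (c :+ d)) :+ ((a′ :+ b′) :- (c′ :+ d′))) refl _ _ _ _ _ _ _ _

  Δ-* : ∀ c (m : SetFunction n) A B → Δ (λ S → c * m S) A B ≈ c * Δ m A B
  Δ-* c m A B = solve 5
    (λ k a b c d → (k :* a :+ k :* b) :- (k :* c :+ k :* d) :=
      k :* ((a :+ b) :- (c :+ d))) refl c _ _ _ _

  Δ-- : ∀ (m m′ : SetFunction n) A B → Δ (λ S → m S - m′ S) A B ≈ Δ m A B - Δ m′ A B
  Δ-- m m′ A B = solve 8
    (λ a b c d a′ b′ c′ d′ → (a :- a′ :+ (b :- b′)) :- (c :- c′ :+ (d :- d′)) :=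
      ((a :+ b) :- (c :+ d)) :- ((a′ :+ b′) :- (c′ :+ d′))) refl _ _ _ _ _ _ _ _

  𝓚⇒0≤Δ : 𝓚 N m → ∀ A B → A ⊆ N → B ⊆ N → 0# ≤ Δ m A B
  𝓚⇒0≤Δ mK A B A⊆N B⊆N = ≤⇒0≤- (mK A B A⊆N B⊆N)

  0≤Δ⇒𝓚 : (∀ A B → A ⊆ N → B ⊆ N → 0# ≤ Δ m A B) → 𝓚 N m
  0≤Δ⇒𝓚 h A B A⊆N B⊆N = 0≤-⇒≤ (h A B A⊆N B⊆N)

  𝓛⇒Δ≈0 : 𝓛 N m → ∀ A B → A ⊆ N → B ⊆ N → Δ m A B ≈ 0#
  𝓛⇒Δ≈0 mL A B A⊆N B⊆N = x≈y⇒x-y≈0 (sym (mL A B A⊆N B⊆N))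

  Δ≈0⇒𝓛 : (∀ A B → A ⊆ N → B ⊆ N → Δ m A B ≈ 0#) → 𝓛 N m
  Δ≈0⇒𝓛 h A B A⊆N B⊆N = sym (x-y≈0⇒x≈y (h A B A⊆N B⊆N))

  𝓛⇒𝓚 : 𝓛 N m → 𝓚 N m
  𝓛⇒𝓚 mL A B A⊆N B⊆N = ≤-reflexive (mL A B A⊆N B⊆N)

  Tight⊆ : Subset n → SetFunction n → SetFunction n → Set
  Tight⊆ N m m′ = ∀ A B → A ⊆ N → B ⊆ N → Δ m A B ≈ 0# → Δ m′ A B ≈ 0#

  Tight⊆-trans : Tight⊆ N m m′ → Tight⊆ N m′ m″ → Tight⊆ N m m″
  Tight⊆-trans p q A B A⊆N B⊆N = q A B A⊆N B⊆N ∘ p A B A⊆N B⊆N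

  𝓛-Tight⊆ : 𝓛 N m → Tight⊆ N m m′ → 𝓛 N m′
  𝓛-Tight⊆ mL t = Δ≈0⇒𝓛 λ A B A⊆N B⊆N → t A B A⊆N B⊆N (𝓛⇒Δ≈0 mL A B A⊆N B⊆N)

  Tight⊆-𝓛 : 𝓛 N m′ → Tight⊆ N m m′
  Tight⊆-𝓛 mL A B A⊆N B⊆N _ = 𝓛⇒Δ≈0 mL A B A⊆N B⊆N

  -- The scalar product

  ∑⊆-cong : ∀ (N : Subset n) {f g} → (∀ S → f S ≈ g S) → ∑⊆ N f ≈ ∑⊆ N g
  ∑⊆-cong []            f≈g = f≈g []
  ∑⊆-cong (outside ∷ N) f≈g = ∑⊆-cong N (f≈g ∘ (outside ∷_))
  ∑⊆-cong (inside  ∷ N) f≈g =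
    +-cong (∑⊆-cong N (f≈g ∘ (outside ∷_))) (∑⊆-cong N (f≈g ∘ (inside ∷_)))

  ∑⊆-0 : ∀ (N : Subset n) → ∑⊆ N (λ _ → 0#) ≈ 0#
  ∑⊆-0 []            = refl
  ∑⊆-0 (outside ∷ N) = ∑⊆-0 N
  ∑⊆-0 (inside  ∷ N) = trans (+-cong (∑⊆-0 N) (∑⊆-0 N)) (+-identityˡ 0#)

  ∑⊆-linear : ∀ (N : Subset n) (f : SetFunction n) c g →
              ∑⊆ N (λ S → f S + c * g S) ≈ ∑⊆ N f + c * ∑⊆ N g
  ∑⊆-linear []            f c g = refl
  ∑⊆-linear (outside ∷ N) f c g = ∑⊆-linear N (f ∘ (outside ∷_)) c (g ∘ (outside ∷_))
  ∑⊆-linear (inside  ∷ N) f c g = trans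
    (+-cong (∑⊆-linear N (f ∘ (outside ∷_)) c (g ∘ (outside ∷_)))
            (∑⊆-linear N (f ∘ (inside ∷_)) c (g ∘ (inside ∷_))))
    (solve 5 (λ a b a′ b′ c → (a :+ c :* b) :+ (a′ :+ c :* b′) := (a :+ a′) :+ c :* (b :+ b′))
      refl _ _ _ _ c)

  scalarProduct-linearˡ : ∀ (N : Subset n) m c m′ v →
    scalarProduct N (λ S → m S + c * m′ S) v ≈ scalarProduct N m v + c * scalarProduct N m′ v
  scalarProduct-linearˡ N m c m′ v = trans
    (∑⊆-cong N λ S → solve 4 (λ a c b v → (a :+ c :* b) :* v := a :* v :+ c :* (b :* v))
      refl (m S) c (m′ S) (v S))
    (∑⊆-linear N _ c _)

  scalarProduct-linearʳ : ∀ (N : Subset n) m v c v′ →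
    scalarProduct N m (λ S → v S + c * v′ S) ≈ scalarProduct N m v + c * scalarProduct N m v′
  scalarProduct-linearʳ N m v c v′ = trans
    (∑⊆-cong N λ S → solve 4 (λ m v c v′ → m :* (v :+ c :* v′) := m :* v :+ c :* (m :* v′))
      refl (m S) (v S) c (v′ S))
    (∑⊆-linear N _ c _)

  scalarProduct-0ʳ : ∀ (N : Subset n) m → scalarProduct N m (λ _ → 0#) ≈ 0#
  scalarProduct-0ʳ N m = trans (∑⊆-cong N λ S → zeroʳ (m S)) (∑⊆-0 N)

  δ : Subset n → SetFunction n
  δ []            []            = 1#
  δ (outside ∷ A) (outside ∷ S) = δ A S
  δ (outside ∷ A) (inside  ∷ S) = 0#
  δ (inside  ∷ A) (outside ∷ S) = 0#
  δ (inside  ∷ A) (inside  ∷ S) = δ A S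

  scalarProduct-δ : ∀ (N : Subset n) m A → A ⊆ N → scalarProduct N m (δ A) ≈ m A
  scalarProduct-δ []            m []            A⊆N = *-identityʳ (m [])
  scalarProduct-δ (outside ∷ N) m (outside ∷ A) A⊆N =
    scalarProduct-δ N (m ∘ (outside ∷_)) A (drop-∷-⊆ A⊆N)
  scalarProduct-δ (outside ∷ N) m (inside  ∷ A) A⊆N with () ← A⊆N Vec.here
  scalarProduct-δ (inside  ∷ N) m (outside ∷ A) A⊆N = trans
    (+-cong (scalarProduct-δ N (m ∘ (outside ∷_)) A (drop-∷-⊆ A⊆N))
            (scalarProduct-0ʳ N (m ∘ (inside ∷_))))
    (+-identityʳ _)
  scalarProduct-δ (inside  ∷ N) m (inside  ∷ A) A⊆N = trans
    (+-cong (scalarProduct-0ʳ N (m ∘ (outside ∷_)))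
            (scalarProduct-δ N (m ∘ (inside ∷_)) A (drop-∷-⊆ A⊆N)))
    (+-identityˡ _)

  -- The functional `m ↦ Δ m A B` as a vector. Every summand has the shape `v + c * v′`, so that
  -- `scalarProduct-linearʳ` can peel them off one by one.
  defect : Subset n → Subset n → SetFunction n
  defect A B S = ((δ (A ∪ B) S + 1# * δ (A ∩ B) S) + - 1# * δ A S) + - 1# * δ B S

  ∪-⊆ : A ⊆ N → B ⊆ N → A ∪ B ⊆ N
  ∪-⊆ {A = A} {B = B} A⊆N B⊆N i∈ with x∈p∪q⁻ A B i∈
  ... | inj₁ i∈A = A⊆N i∈A
  ... | inj₂ i∈B = B⊆N i∈B

  ∩-⊆ : A ⊆ N → A ∩ B ⊆ N
  ∩-⊆ {A = A} {B = B} A⊆N = A⊆N ∘ p∩q⊆p A B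

  scalarProduct-defect : ∀ (N : Subset n) m A B → A ⊆ N → B ⊆ N →
                         scalarProduct N m (defect A B) ≈ Δ m A B
  scalarProduct-defect N m A B A⊆N B⊆N = begin
    scalarProduct N m (defect A B)
      ≈⟨ scalarProduct-linearʳ N m _ (- 1#) (δ B) ⟩
    _ + - 1# * scalarProduct N m (δ B)
      ≈⟨ +-congʳ (scalarProduct-linearʳ N m _ (- 1#) (δ A)) ⟩
    (_ + - 1# * scalarProduct N m (δ A)) + - 1# * scalarProduct N m (δ B)
      ≈⟨ +-congʳ (+-congʳ (scalarProduct-linearʳ N m _ 1# (δ (A ∩ B)))) ⟩
    ((scalarProduct N m (δ (A ∪ B)) + 1# * scalarProduct N m (δ (A ∩ B)))
      + - 1# * scalarProduct N m (δ A)) + - 1# * scalarProduct N m (δ B)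
      ≈⟨ +-cong (+-cong (+-cong (scalarProduct-δ N m _ (∪-⊆ A⊆N B⊆N))
                                (*-congˡ (scalarProduct-δ N m _ (∩-⊆ {B = B} A⊆N))))
                        (*-congˡ (scalarProduct-δ N m _ A⊆N)))
                (*-congˡ (scalarProduct-δ N m _ B⊆N)) ⟩
    ((m (A ∪ B) + 1# * m (A ∩ B)) + - 1# * m A) + - 1# * m B
      ≈⟨ +-cong (+-cong (+-congˡ (*-identityˡ _)) -1*) -1* ⟩
    ((m (A ∪ B) + m (A ∩ B)) - m A) - m B
      ≈⟨ solve 4 (λ u i a b → u :+ i :- a :- b := u :+ i :- (a :+ b)) refl _ _ _ _ ⟩
    Δ m A B ∎
    where
    -1* : ∀ {x} → - 1# * x ≈ - x
    -1* {x} = trans (solve 2 (λ o x → (:- o) :* x := :- (o :* x)) refl 1# x)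
                    (-‿cong (*-identityˡ x))

  -- Faces of the cone of supermodular functions

  -- A face of the cone at level 0, seen as a property: one functional, nonnegative on the cone,
  -- vanishes exactly where `P` holds.
  Exposed : Subset n → Pred (Pred (SetFunction n) 0ℓ) 0ℓ
  Exposed N P = ∃ λ v → ∀ m → 𝓚 N m →
    0# ≤ scalarProduct N m v × (scalarProduct N m v ≈ 0# ⇔ P m)

  Exposed-map : ∀ (N : Subset n) P Q → (∀ m → P m ⇔ Q m) → Exposed N P → Exposed N Q
  Exposed-map N P Q P⇔Q (v , h) = v , λ m mK →
    let (nonneg , iff) = h m mK in
    nonneg , mk⇔ (Equivalence.to (P⇔Q m) ∘ Equivalence.to iff)
                 (Equivalence.from iff ∘ Equivalence.from (P⇔Q m))

  -- The two functionals are added: a sum of nonnegative numbers vanishes only if both do.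
  Exposed-× : ∀ (N : Subset n) P Q → Exposed N P → Exposed N Q → Exposed N (λ m → P m × Q m)
  Exposed-× N P Q (v , h) (w , g) = (λ S → v S + 1# * w S) , λ m mK →
    let (0≤v , v⇔) = h m mK
        (0≤w , w⇔) = g m mK
        sum : scalarProduct N m (λ S → v S + 1# * w S) ≈ scalarProduct N m v + scalarProduct N m w
        sum = trans (scalarProduct-linearʳ N m v 1# w) (+-congˡ (*-identityˡ _))
    in ≤-respʳ-≈ (sym sum) (0≤-+ 0≤v 0≤w)
     , mk⇔ (λ s≈0 →
              Equivalence.to v⇔ (0≤-+≈0⇒≈0 0≤v 0≤w (trans (sym sum) s≈0)) ,
              Equivalence.to w⇔
                (0≤-+≈0⇒≈0 0≤w 0≤v (trans (+-comm _ _) (trans (sym sum) s≈0))))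
           (λ (p , q) → trans sum
              (trans (+-cong (Equivalence.from v⇔ p) (Equivalence.from w⇔ q)) (+-identityˡ 0#)))

  -- A pair that is tight for `m` is exposed by its `defect`; any other pair imposes no condition
  -- and is exposed by the zero vector. Finite conjunction combines all pairs.
  Exposed-Tight⊆ : ∀ (N : Subset n) m → Exposed N (Tight⊆ N m)
  Exposed-Tight⊆ N m =
    ∀-Subset (Exposed N) (Exposed-× N) (Exposed-map N) _ λ A →
    ∀-Subset (Exposed N) (Exposed-× N) (Exposed-map N) _ λ B → pair A B
    where
    TightAt : Subset _ → Subset _ → Pred (SetFunction _) 0ℓ
    TightAt A B m′ = A ⊆ N → B ⊆ N → Δ m A B ≈ 0# → Δ m′ A B ≈ 0#

    trivial : ∀ A B → (∀ m′ → TightAt A B m′) → Exposed N (TightAt A B)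
    trivial A B p = (λ _ → 0#) , λ m′ _ → ≤-reflexive (sym (scalarProduct-0ʳ N m′)) ,
      mk⇔ (λ _ → p m′) (λ _ → scalarProduct-0ʳ N m′)

    pair : ∀ A B → Exposed N (TightAt A B)
    pair A B with A ⊆? N | B ⊆? N | Δ m A B ≟ 0#
    ... | no A⊈N  | _       | _       = trivial A B λ _ A⊆N → ⊥-elim (A⊈N A⊆N)
    ... | yes _   | no B⊈N  | _       = trivial A B λ _ _ B⊆N → ⊥-elim (B⊈N B⊆N)
    ... | yes _   | yes _   | no Δ≉0  = trivial A B λ _ _ _ Δ≈0 → contradiction Δ≈0 Δ≉0
    ... | yes A⊆N | yes B⊆N | yes Δ≈0 = defect A B , λ m′ m′K →
      let eq = scalarProduct-defect N m′ A B A⊆N B⊆N in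
      ≤-respʳ-≈ (sym eq) (𝓚⇒0≤Δ m′K A B A⊆N B⊆N) ,
      mk⇔ {B = TightAt A B m′}
        (λ s≈0 _ _ _ → trans (sym eq) s≈0) (λ h → trans eq (h A⊆N B⊆N Δ≈0))

  tightFace : ∀ (N : Subset n) → SetFunction n → Face N (𝓚 N)
  tightFace N m = record
    { v = proj₁ (Exposed-Tight⊆ N m)
    ; k = 0#
    ; valid = λ m′ m′K → proj₁ (proj₂ (Exposed-Tight⊆ N m) m′ m′K)
    }

  tightFace⁻ : members (tightFace N m) m′ → Tight⊆ N m m′
  tightFace⁻ {N = N} {m = m} (m′K , 0≈) =
    Equivalence.to (proj₂ (proj₂ (Exposed-Tight⊆ N m) _ m′K)) (sym 0≈)

  tightFace⁺ : 𝓚 N m′ → Tight⊆ N m m′ → members (tightFace N m) m′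
  tightFace⁺ {N = N} {m = m} m′K t =
    m′K , sym (Equivalence.from (proj₂ (proj₂ (Exposed-Tight⊆ N m) _ m′K)) t)

  -- The cone contains m - m and m + m. Validity of the face inequality there gives k ≤ 0 and k ≤
  -- 2k.
  face-level : (G : Face N (𝓚 N)) → members G m → Face.k G ≈ 0#
  face-level {N = N} {m = m} G (mK , k≈) = antisym
    (≤-respʳ-≈ (cancel s) (level-≤ (- 1#) λ A B A⊆N B⊆N → ≤-reflexive (sym (cancel (Δ m A B)))))
    (≤-cong (-‿inverseʳ k) cancel-k (+-monoˡ-≤ (- k) (level-≤ 1# λ A B A⊆N B⊆N →
      let 0≤Δ = 𝓚⇒0≤Δ mK A B A⊆N B⊆N in
      0≤-+ 0≤Δ (*-nonneg 0≤1 0≤Δ))))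
    where
    open Face G
    s = scalarProduct N m v

    cancel : ∀ a → a + - 1# * a ≈ 0#
    cancel a = trans (+-congʳ (sym (*-identityˡ a)))
      (trans (solve 2 (λ o a → o :* a :+ (:- o) :* a := a :- a) refl 1# a) (-‿inverseʳ a))

    cancel-k : s + 1# * s - k ≈ k
    cancel-k = trans (+-cong (+-cong (sym k≈) (trans (*-identityˡ s) (sym k≈))) refl)
                     (solve 1 (λ k → k :+ k :- k := k) refl k)

    level-≤ : ∀ c → (∀ A B → A ⊆ N → B ⊆ N → 0# ≤ Δ m A B + c * Δ m A B) → k ≤ s + c * s
    level-≤ c h = ≤-respʳ-≈ (scalarProduct-linearˡ N m c m v)
      (valid _ (0≤Δ⇒𝓚 λ A B A⊆N B⊆N →
        ≤-respʳ-≈ (sym (trans (Δ-+ m _ A B) (+-congˡ (Δ-* c m A B)))) (h A B A⊆N B⊆N)))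

  -- Where `Δ m` vanishes, so does `Δ m′`; elsewhere `Δ m` is positive and leaves room to subtract.
  -- Finitely many pairs admit a common ε.
  small-step : ∀ (N : Subset n) m m′ → 𝓚 N m → 𝓚 N m′ → Tight⊆ N m m′ →
               ∃ λ ε → Positive ε × 𝓚 N (λ S → m S + - ε * m′ S)
  small-step N m m′ mK m′K t =
    let (ε , ε>0 , h) = uniform in
    ε , ε>0 , 0≤Δ⇒𝓚 λ A B A⊆N B⊆N →
      ≤-respʳ-≈
        (trans (solve 3 (λ d ε d′ → d :- ε :* d′ := d :+ (:- ε) :* d′) refl _ ε _)
          (sym (trans (Δ-+ m _ A B) (+-congˡ (Δ-* (- ε) m′ A B)))))
        (≤⇒0≤- (h ε (proj₁ ε>0) ≤-refl A B A⊆N B⊆N))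
    where
    pair : ∀ A B → ForSmall (λ ε → A ⊆ N → B ⊆ N → ε * Δ m′ A B ≤ Δ m A B)
    pair A B with A ⊆? N | B ⊆? N
    ... | no A⊈N  | _       = 1# , 1-positive , λ _ _ _ A⊆N → ⊥-elim (A⊈N A⊆N)
    ... | yes _   | no B⊈N  = 1# , 1-positive , λ _ _ _ _ B⊆N → ⊥-elim (B⊈N B⊆N)
    ... | yes A⊆N | yes B⊆N =
      let 0≤Δ′ = 𝓚⇒0≤Δ m′K A B A⊆N B⊆N
          (ε , ε>0 , εΔ′≤Δ) = rescale (𝓚⇒0≤Δ mK A B A⊆N B⊆N) 0≤Δ′ (t A B A⊆N B⊆N)
      in ε , ε>0 , λ δ _ δ≤ε _ _ →
        ≤-trans (≤-cong (*-comm _ _) (*-comm _ _) (*-mono-≤ 0≤Δ′ δ≤ε)) εΔ′≤Δ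

    uniform : ForSmall (λ ε → ∀ A B → A ⊆ N → B ⊆ N → ε * Δ m′ A B ≤ Δ m A B)
    uniform = ∀-Subset ForSmall ForSmall-× ForSmall-map _ λ A →
              ∀-Subset ForSmall ForSmall-× ForSmall-map _ λ B → pair A B

  -- Since `m` sits at level 0, the functional of `G` takes the value -ε⟨m′,v⟩ at the function m - ε
  -- m′ from `small-step`. This is nonnegative, and so is ⟨m′,v⟩, which is therefore 0.
  tightFace-smallest : (G : Face N (𝓚 N)) → members G m → 𝓚 N m′ → Tight⊆ N m m′ → members G m′
  tightFace-smallest {N = N} {m = m} {m′ = m′} G mG@(mK , k≈) m′K t =
    m′K , trans k≈0 (sym (s′≈0 (small-step N m m′ mK m′K t)))
    where
    open Face G
    k≈0 = face-level G mG
    s′ = scalarProduct N m′ v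

    0≤s′ : 0# ≤ s′
    0≤s′ = ≤-respˡ-≈ k≈0 (valid m′ m′K)

    step : ∀ ε → scalarProduct N (λ S → m S + - ε * m′ S) v ≈ - (ε * s′)
    step ε = begin
      scalarProduct N (λ S → m S + - ε * m′ S) v   ≈⟨ scalarProduct-linearˡ N m (- ε) m′ v ⟩
      scalarProduct N m v + - ε * s′               ≈⟨ +-congʳ (trans (sym k≈) k≈0) ⟩
      0# + - ε * s′                                ≈⟨ +-identityˡ _ ⟩
      - ε * s′                                     ≈⟨ solve 2 (λ ε s → (:- ε) :* s := :- (ε :* s))
                                                        refl ε s′ ⟩
      - (ε * s′)                                   ∎

    s′≈0 : (∃ λ ε → Positive ε × 𝓚 N (λ S → m S + - ε * m′ S)) → s′ ≈ 0#
    s′≈0 (ε , (0≤ε , ε≉0) , stepK) = *≈0⇒≈0 ε≉0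
      (0≤-+≈0⇒≈0 (*-nonneg 0≤ε 0≤s′) (≤-cong k≈0 (step ε) (valid _ stepK)) (-‿inverseʳ _))

  -- Extremality without faces or functionals: only values of `Δ` occur, and these are what
  -- replication controls.
  TightMaximal : Subset n → Pred (SetFunction n) 0ℓ
  TightMaximal N m = 𝓚 N m × ¬ 𝓛 N m ×
    (∀ m′ → 𝓚 N m′ → Tight⊆ N m m′ → 𝓛 N m′ ⊎ Tight⊆ N m′ m)

  -- The smallest face `F` has the same members as the tight face of `m`: one inclusion is its
  -- minimality, the other is `tightFace-smallest`. Atomicity is then applied to the tight face of
  -- `m′`.
  Extreme⇒TightMaximal : Extreme N m → TightMaximal N m
  Extreme⇒TightMaximal {N = N} {m = m} (mK , F , (mF , F-smallest) , _ , F≢𝓛 , F-atom) =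
    mK , m∉𝓛 , maximal
    where
    F⊆tight : ∀ {g} → members F g → Tight⊆ N m g
    F⊆tight gF =
      tightFace⁻ {m = m} (F-smallest (tightFace N m) (tightFace⁺ mK λ _ _ _ _ h → h) gF)

    m∉𝓛 : ¬ 𝓛 N m
    m∉𝓛 mL = F≢𝓛
      ( (λ gF → 𝓛-Tight⊆ mL (F⊆tight gF))
      , (λ gL → tightFace-smallest F mF (𝓛⇒𝓚 gL) (Tight⊆-𝓛 gL)))

    maximal : ∀ m′ → 𝓚 N m′ → Tight⊆ N m m′ → 𝓛 N m′ ⊎ Tight⊆ N m′ m
    maximal m′ m′K t = Sum.map
      (λ (G⊆𝓛 , _) → G⊆𝓛 m′G)
      (λ (_ , F⊆G) → tightFace⁻ {m = m′} (F⊆G mF))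
      (F-atom (tightFace N m′) (m′ , m′G) G⊆F)
      where
      m′G : members (tightFace N m′) m′
      m′G = tightFace⁺ m′K λ _ _ _ _ h → h

      G⊆F : members (tightFace N m′) Pred.⊆ members F
      G⊆F {g} gG = tightFace-smallest F mF (proj₁ gG)
        (Tight⊆-trans {m = m} {m′ = m′} {m″ = g} t (tightFace⁻ {m = m′} gG))

  TightMaximal⇒Extreme : TightMaximal N m → Extreme N m
  TightMaximal⇒Extreme {N = N} {m = m} (mK , m∉𝓛 , maximal) =
    mK , F , (mF , λ G mG {g} gF → F⊆ G mG gF) ,
    (m , mF) , (λ (F⊆𝓛 , _) → m∉𝓛 (F⊆𝓛 mF)) , atom
    where
    F = tightFace N m

    mF : members F m
    mF = tightFace⁺ mK λ _ _ _ _ h → h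

    F⊆ : ∀ G → members G m → members F Pred.⊆ members G
    F⊆ G mG gF = tightFace-smallest G mG (proj₁ gF) (tightFace⁻ {m = m} gF)

    atom : (G : Face N (𝓚 N)) → ∃ (members G) → members G Pred.⊆ members F →
           (members G ≐ 𝓛 N) ⊎ (members G ≐ members F)
    -- As `m` is supermodular, this equality decides whether `m` belongs to `G`.
    atom G (g , gG) G⊆F with Face.k G ≟ scalarProduct N m (Face.v G)
    ... | yes k≈ = inj₂ (G⊆F , F⊆ G (mK , k≈))
    ... | no  k≉ = inj₁ (G⊆𝓛 , λ lL → tightFace-smallest G gG (𝓛⇒𝓚 lL) (Tight⊆-𝓛 lL))
      where
      G⊆𝓛 : members G Pred.⊆ 𝓛 N
      -- In the other alternative of maximality, `m` satisfies all equalities of `h`, which would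
      -- put `m` into `G`.
      G⊆𝓛 {h} hG = Sum.fromInj₁
        (λ t → contradiction (proj₂ (tightFace-smallest G hG mK t)) k≉)
        (maximal h (proj₁ hG) (tightFace⁻ {m = m} (G⊆F hG)))

-- Singletons and membership in finite subsets

⁅⁆⊆ : ∀ {n} {i : Fin n} {S} → i ∈ S → ⁅ i ⁆ ⊆ S
⁅⁆⊆ {i = i} {S} i∈S j∈ = ≡.subst (_∈ S) (≡.sym (x∈⁅y⁆⇒x≡y i j∈)) i∈S

⁅⁆∩⊆∅ : ∀ {n} {i : Fin n} {S} → i ∉ S → ⁅ i ⁆ ∩ S ⊆ ∅
⁅⁆∩⊆∅ {i = i} {S} i∉S j∈ with x∈p∩q⁻ ⁅ i ⁆ S j∈
... | j∈i , j∈S = ⊥-elim (i∉S (≡.subst (_∈ S) (x∈⁅y⁆⇒x≡y i j∈i) j∈S))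

∣p∣≡1⇒unique : ∀ {n} {p : Subset n} {i j} → ∣ p ∣ ≡ 1 → i ∈ p → j ∈ p → i ≡ j
∣p∣≡1⇒unique {p = p} {i} {j} ∣p∣≡1 i∈p j∈p with i Fin.≟ j
... | yes i≡j = i≡j
-- Removing `i` leaves `j` behind, so the remaining cardinality is positive, yet it is below 1.
... | no  i≢j = contradiction
  (ℕ.≤-<-trans ℕ.z≤n (x∈p⇒∣p-x∣<∣p∣ (x∈p∧x≢y⇒x∈p-y j∈p (i≢j ∘ ≡.sym))))
  (ℕ.<⇒≱ (≡.subst (∣ p ─ ⁅ i ⁆ ∣ ℕ.<_) ∣p∣≡1 (x∈p⇒∣p-x∣<∣p∣ i∈p)))

does-∈? : ∀ {n} (i : Fin n) S → does (i ∈? S) ≡ lookup S i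
does-∈? zero    (inside  ∷ S) = ≡.refl
does-∈? zero    (outside ∷ S) = ≡.refl
does-∈? (suc i) (_       ∷ S) = does-∈? i S

-- Point weights as modular functions, and lower standardization

module Weights (ℝ : RealNumbers) where

  open RealNumbers ℝ hiding (zero)
  open SetFunctions ℝ hiding (Carrier; _≈_; _≤_; _<_; _+_; _*_; _-_; 0#; 1#)
  open OrderedField ℝ
  open SupermodularCone ℝ
  open import Algebra.Properties.Ring ring using (-0#≈0#)
  open import Algebra.Properties.CommutativeMonoid.Sum +-commutativeMonoid using (sum)

  private
    variable
      n : ℕ
      S : Subset n
      i : Fin n
      c : Carrier

  -- Unfolds to the summand of `lowerStd`, so that a lower standardization is a shift by a constant
  -- plus a sum of weights.
  weight : Fin n → Carrier → SetFunction n
  weight i c S = if does (i ∈? S) then c else 0#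

  weight-∈ : i ∈ S → weight i c S ≈ c
  weight-∈ {i = i} {S = S} i∈S with i ∈? S
  ... | yes _  = refl
  ... | no i∉S = ⊥-elim (i∉S i∈S)

  weight-∉ : i ∉ S → weight i c S ≈ 0#
  weight-∉ {i = i} {S = S} i∉S with i ∈? S
  ... | yes i∈S = ⊥-elim (i∉S i∈S)
  ... | no _    = refl

  -- Membership of `i` in a union or intersection is a Boolean operation on its membership in `A`
  -- and `B`, which leaves four patterns.
  Δ-weight : ∀ i c (A B : Subset n) → Δ (weight i c) A B ≈ 0#
  Δ-weight i c A B
    rewrite does-∈? i (A ∪ B) | does-∈? i (A ∩ B) | does-∈? i A | does-∈? i B
          | lookup-zipWith _∨_ i A B | lookup-zipWith _∧_ i A B
    with lookup A i | lookup B i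
  ... | true  | true  = -‿inverseʳ _
  ... | true  | false = -‿inverseʳ _
  ... | false | true  = trans (+-congˡ (-‿cong (+-comm _ _))) (-‿inverseʳ _)
  ... | false | false = -‿inverseʳ _

  Δ-const : ∀ c (A B : Subset n) → Δ (λ _ → c) A B ≈ 0#
  Δ-const c A B = -‿inverseʳ (c + c)

  Δ-sum : ∀ {k} (f : Fin k → SetFunction n) (A B : Subset n) →
          (∀ i → Δ (f i) A B ≈ 0#) → Δ (λ S → sum λ i → f i S) A B ≈ 0#
  Δ-sum {k = zero}  f A B Δ≈0 = Δ-const 0# A B
  Δ-sum {k = suc k} f A B Δ≈0 = trans (Δ-+ (f zero) _ A B)
    (trans (+-cong (Δ≈0 zero) (Δ-sum (f ∘ suc) A B (Δ≈0 ∘ suc))) (+-identityˡ 0#))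

  sum-0 : ∀ {k} (f : Fin k → Carrier) → (∀ i → f i ≈ 0#) → sum f ≈ 0#
  sum-0 {zero}  f f≈0 = refl
  sum-0 {suc k} f f≈0 =
    trans (+-cong (f≈0 zero) (sum-0 (f ∘ suc) (f≈0 ∘ suc))) (+-identityˡ 0#)

  sum-only : ∀ {k} (f : Fin k → Carrier) j → (∀ i → i ≢ j → f i ≈ 0#) → sum f ≈ f j
  sum-only f zero    f≈0 =
    trans (+-congˡ (sum-0 (f ∘ suc) λ i → f≈0 (suc i) λ ())) (+-identityʳ _)
  sum-only f (suc j) f≈0 =
    trans (+-cong (f≈0 zero λ ()) (sum-only (f ∘ suc) j λ i i≢j → f≈0 (suc i) (i≢j ∘ Fin.suc-injective)))
          (+-identityˡ _)

  Δ-lowerStd : ∀ (r : SetFunction n) A B → Δ (lowerStd r) A B ≈ Δ r A B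
  Δ-lowerStd r A B = trans
    (trans (Δ-+ (λ S → r S - r ∅) _ A B)
      (+-cong (trans (Δ-- r _ A B) (+-congˡ (-‿cong (Δ-const (r ∅) A B))))
              (Δ-sum _ A B λ i → Δ-weight i (r ∅ - r ⁅ i ⁆) A B)))
    (trans (+-identityʳ _) (trans (+-congˡ -0#≈0#) (+-identityʳ _)))

  lowerStd-∅ : ∀ (r : SetFunction n) → lowerStd r ∅ ≈ 0#
  lowerStd-∅ r = trans
    (+-cong (-‿inverseʳ _)
            (sum-0 (λ i → weight i (r ∅ - r ⁅ i ⁆) ∅) λ i → weight-∉ {i = i} ∉⊥))
    (+-identityˡ 0#)

  lowerStd-⁅⁆ : ∀ (r : SetFunction n) i → lowerStd r ⁅ i ⁆ ≈ 0#
  lowerStd-⁅⁆ r i = trans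
    (+-congˡ (trans
      (sum-only (λ j → weight j (r ∅ - r ⁅ j ⁆) ⁅ i ⁆) i λ j j≢i → weight-∉ (x≢y⇒x∉⁅y⁆ j≢i))
      (weight-∈ (x∈⁅x⁆ i))))
    (trans (solve 2 (λ a b → (a :- b) :+ (b :- a) := a :- a) refl (r ⁅ i ⁆) (r ∅))
           (-‿inverseʳ _))

-- Contracting the pair x, y to the point z, and expanding z back

module Contraction {n} (N M : Subset n) (x y z : Fin n) (z∈M : z ∈ M) (L⊆N : M ─ ⁅ z ⁆ ⊆ N)
                   (N─L≡xy : N ─ (M ─ ⁅ z ⁆) ≡ ⁅ x ⁆ ∪ ⁅ y ⁆) (x≢y : x ≢ y) where

  open SetSolver

  X Y Z L XY : Subset n
  X  = ⁅ x ⁆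
  Y  = ⁅ y ⁆
  Z  = ⁅ z ⁆
  L  = M ─ Z
  XY = X ∪ Y

  private
    variable
      A B S : Subset n

  -- The five standing sets occupy fixed positions in every `env`; `tA`, `tB`, `tC` name the sets
  -- appended to them. `tL` is a compound term, so the solver knows that L misses z and lies in M.
  tN tM tX tY tZ tL tXY : ∀ {k} → Term (5 ℕ.+ k)
  tN  = var zero
  tM  = var (suc zero)
  tX  = var (suc (suc zero))
  tY  = var (suc (suc (suc zero)))
  tZ  = var (suc (suc (suc (suc zero))))
  tL  = tM :─ tZ
  tXY = tX :∪ tY

  tA : ∀ {k} → Term (6 ℕ.+ k)
  tA = var (suc (suc (suc (suc (suc zero)))))

  tB : ∀ {k} → Term (7 ℕ.+ k)
  tB = var (suc (suc (suc (suc (suc (suc zero))))))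

  tC : ∀ {k} → Term (8 ℕ.+ k)
  tC = var (suc (suc (suc (suc (suc (suc (suc zero)))))))

  env : ∀ {k} → Vec (Subset n) k → Vec (Subset n) (5 ℕ.+ k)
  env ρ = N ∷ M ∷ X ∷ Y ∷ Z ∷ ρ

  -- No fact separates `Z` from `X` or `Y`, because z may coincide with x or y.
  setup : ∀ {k} (ρ : Vec (Subset n) k) → List (Fact (env ρ))
  setup ρ =
    (tZ :⊆ tM         , ⁅⁆⊆ z∈M) ∷
    (tL :⊆ tN         , L⊆N) ∷
    (tN :─ tL :⊆ tXY  , ≡.subst (N ─ L ⊆_) N─L≡xy id) ∷
    (tXY :⊆ tN :─ tL  , ≡.subst (XY ⊆_) (≡.sym N─L≡xy) id) ∷
    (tX :∩ tY :⊆ :∅   , ⁅⁆∩⊆∅ (x≢y⇒x∉⁅y⁆ x≢y)) ∷ []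

  x∈XY : x ∈ XY
  x∈XY = p⊆p∪q Y (x∈⁅x⁆ x)

  y∈XY : y ∈ XY
  y∈XY = q⊆p∪q X Y (x∈⁅x⁆ y)

  XY⊈∩L : ∀ S → XY ⊈ S ∩ L
  XY⊈∩L S XY⊆ = ∉⊥ (prove-⊆ (env (S ∷ []))
    ((tXY :⊆ tA :∩ tL , XY⊆) ∷ setup (S ∷ [])) tX :∅ (x∈⁅x⁆ x))

  contract : Subset n → Subset n
  contract S = if does (XY ⊆? S) then Z ∪ (S ∩ L) else S ∩ L

  contract-full : XY ⊆ S → contract S ≡ Z ∪ (S ∩ L)
  contract-full {S} XY⊆S with XY ⊆? S
  ... | yes _    = ≡.refl
  ... | no XY⊈S  = ⊥-elim (XY⊈S XY⊆S)

  contract-partial : XY ⊈ S → contract S ≡ S ∩ L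
  contract-partial {S} XY⊈S with XY ⊆? S
  ... | yes XY⊆S = ⊥-elim (XY⊈S XY⊆S)
  ... | no _     = ≡.refl

  contract⊆M : ∀ S → contract S ⊆ M
  contract⊆M S with XY ⊆? S
  ... | yes _ = prove-⊆ (env (S ∷ [])) (setup (S ∷ [])) (tZ :∪ tA :∩ tL) tM
  ... | no _  = prove-⊆ (env (S ∷ [])) (setup (S ∷ [])) (tA :∩ tL) tM

  -- `XY ⊆ A ∩ B` holds exactly when `XY` lies in both sets. A union has no such equivalence, whence
  -- the second alternative of `contract-∪`.
  contract-∩ : ∀ A B → contract (A ∩ B) ≡ contract A ∩ contract B
  contract-∩ A B with XY ⊆? A | XY ⊆? B
  ... | yes p | yes q = ≡.trans
    (contract-full λ i∈ → x∈p∩q⁺ (p i∈ , q i∈))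
    (prove-≡ (env (A ∷ B ∷ [])) (setup (A ∷ B ∷ []))
      (tZ :∪ (tA :∩ tB) :∩ tL) ((tZ :∪ tA :∩ tL) :∩ (tZ :∪ tB :∩ tL)))
  ... | yes p | no q  = ≡.trans
    (contract-partial λ XY⊆ → q (p∩q⊆q A B ∘ XY⊆))
    (prove-≡ (env (A ∷ B ∷ [])) (setup (A ∷ B ∷ []))
      ((tA :∩ tB) :∩ tL) ((tZ :∪ tA :∩ tL) :∩ (tB :∩ tL)))
  ... | no p  | yes q = ≡.trans
    (contract-partial λ XY⊆ → p (p∩q⊆p A B ∘ XY⊆))
    (prove-≡ (env (A ∷ B ∷ [])) (setup (A ∷ B ∷ []))
      ((tA :∩ tB) :∩ tL) ((tA :∩ tL) :∩ (tZ :∪ tB :∩ tL)))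
  ... | no p  | no q  = ≡.trans
    (contract-partial λ XY⊆ → p (p∩q⊆p A B ∘ XY⊆))
    (prove-≡ (env (A ∷ B ∷ [])) (setup (A ∷ B ∷ []))
      ((tA :∩ tB) :∩ tL) ((tA :∩ tL) :∩ (tB :∩ tL)))

  contract-∪ : ∀ A B → (contract (A ∪ B) ≡ contract A ∪ contract B)
                       ⊎ (XY ⊈ A × XY ⊈ B × XY ⊆ A ∪ B)
  contract-∪ A B with XY ⊆? A | XY ⊆? B
  ... | yes p | yes q = inj₁ (≡.trans (contract-full λ i∈ → p⊆p∪q B (p i∈))
    (prove-≡ (env (A ∷ B ∷ [])) (setup (A ∷ B ∷ []))
      (tZ :∪ (tA :∪ tB) :∩ tL) ((tZ :∪ tA :∩ tL) :∪ (tZ :∪ tB :∩ tL))))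
  ... | yes p | no q  = inj₁ (≡.trans (contract-full λ i∈ → p⊆p∪q B (p i∈))
    (prove-≡ (env (A ∷ B ∷ [])) (setup (A ∷ B ∷ []))
      (tZ :∪ (tA :∪ tB) :∩ tL) ((tZ :∪ tA :∩ tL) :∪ (tB :∩ tL))))
  ... | no p  | yes q = inj₁ (≡.trans (contract-full λ i∈ → q⊆p∪q A B (q i∈))
    (prove-≡ (env (A ∷ B ∷ [])) (setup (A ∷ B ∷ []))
      (tZ :∪ (tA :∪ tB) :∩ tL) ((tA :∩ tL) :∪ (tZ :∪ tB :∩ tL))))
  ... | no p  | no q  with XY ⊆? A ∪ B
  ...   | yes XY⊆A∪B = inj₂ (p , q , XY⊆A∪B)
  ...   | no _         = inj₁
    (prove-≡ (env (A ∷ B ∷ [])) (setup (A ∷ B ∷ []))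
      ((tA :∪ tB) :∩ tL) ((tA :∩ tL) :∪ (tB :∩ tL)))

  -- A right inverse of `contract` on the subsets of M. Unlike `contract` it preserves unions as
  -- well as intersections, so it transports `Δ` without exception.
  expand : Subset n → Subset n
  expand S = if does (z ∈? S) then XY ∪ (S ∩ L) else S ∩ L

  expand⊆N : ∀ S → expand S ⊆ N
  expand⊆N S with z ∈? S
  ... | yes _ = prove-⊆ (env (S ∷ [])) (setup (S ∷ [])) (tXY :∪ tA :∩ tL) tN
  ... | no _  = prove-⊆ (env (S ∷ [])) (setup (S ∷ [])) (tA :∩ tL) tN

  expand-∈ : z ∈ S → expand S ≡ XY ∪ (S ∩ L)
  expand-∈ {S} z∈S with z ∈? S
  ... | yes _  = ≡.refl
  ... | no z∉S = ⊥-elim (z∉S z∈S)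

  expand-∉ : z ∉ S → expand S ≡ S ∩ L
  expand-∉ {S} z∉S with z ∈? S
  ... | yes z∈S = ⊥-elim (z∉S z∈S)
  ... | no _    = ≡.refl

  expand-∪ : ∀ A B → expand (A ∪ B) ≡ expand A ∪ expand B
  expand-∪ A B with z ∈? A | z ∈? B
  ... | yes p | yes q = ≡.trans (expand-∈ (p⊆p∪q B p))
    (prove-≡ (env (A ∷ B ∷ [])) []
      (tXY :∪ (tA :∪ tB) :∩ tL) ((tXY :∪ tA :∩ tL) :∪ (tXY :∪ tB :∩ tL)))
  ... | yes p | no q  = ≡.trans (expand-∈ (p⊆p∪q B p))
    (prove-≡ (env (A ∷ B ∷ [])) []
      (tXY :∪ (tA :∪ tB) :∩ tL) ((tXY :∪ tA :∩ tL) :∪ (tB :∩ tL)))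
  ... | no p  | yes q = ≡.trans (expand-∈ (q⊆p∪q A B q))
    (prove-≡ (env (A ∷ B ∷ [])) []
      (tXY :∪ (tA :∪ tB) :∩ tL) ((tA :∩ tL) :∪ (tXY :∪ tB :∩ tL)))
  ... | no p  | no q  = ≡.trans (expand-∉ λ z∈ → Sum.[ p , q ] (x∈p∪q⁻ A B z∈))
    (prove-≡ (env (A ∷ B ∷ [])) []
      ((tA :∪ tB) :∩ tL) ((tA :∩ tL) :∪ (tB :∩ tL)))

  expand-∩ : ∀ A B → expand (A ∩ B) ≡ expand A ∩ expand B
  expand-∩ A B with z ∈? A | z ∈? B
  ... | yes p | yes q = ≡.trans (expand-∈ (x∈p∩q⁺ (p , q)))
    (prove-≡ (env (A ∷ B ∷ [])) []
      (tXY :∪ (tA :∩ tB) :∩ tL) ((tXY :∪ tA :∩ tL) :∩ (tXY :∪ tB :∩ tL)))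
  ... | yes p | no q  = ≡.trans (expand-∉ (q ∘ p∩q⊆q A B))
    (prove-≡ (env (A ∷ B ∷ [])) (setup (A ∷ B ∷ []))
      ((tA :∩ tB) :∩ tL) ((tXY :∪ tA :∩ tL) :∩ (tB :∩ tL)))
  ... | no p  | yes q = ≡.trans (expand-∉ (p ∘ p∩q⊆p A B))
    (prove-≡ (env (A ∷ B ∷ [])) (setup (A ∷ B ∷ []))
      ((tA :∩ tB) :∩ tL) ((tA :∩ tL) :∩ (tXY :∪ tB :∩ tL)))
  ... | no p  | no q  = ≡.trans (expand-∉ (p ∘ p∩q⊆p A B))
    (prove-≡ (env (A ∷ B ∷ [])) []
      ((tA :∩ tB) :∩ tL) ((tA :∩ tL) :∩ (tB :∩ tL)))

  contract-expand : S ⊆ M → contract (expand S) ≡ S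
  contract-expand {S} S⊆M with z ∈? S
  ... | yes z∈S = ≡.trans (contract-full (p⊆p∪q (S ∩ L)))
    (prove-≡ (env (S ∷ [])) ((tZ :⊆ tA , ⁅⁆⊆ z∈S) ∷ (tA :⊆ tM , S⊆M) ∷ setup (S ∷ []))
      (tZ :∪ (tXY :∪ tA :∩ tL) :∩ tL) tA)
  ... | no z∉S  = ≡.trans (contract-partial (XY⊈∩L S))
    (prove-≡ (env (S ∷ [])) ((tZ :∩ tA :⊆ :∅ , ⁅⁆∩⊆∅ z∉S) ∷ (tA :⊆ tM , S⊆M) ∷ setup (S ∷ []))
      ((tA :∩ tL) :∩ tL) tA)

  expand-contract-full : S ⊆ N → XY ⊆ S → expand (contract S) ≡ S
  expand-contract-full {S} S⊆N XY⊆S = ≡.trans (≡.cong expand (contract-full XY⊆S))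
    (≡.trans (expand-∈ (p⊆p∪q (S ∩ L) (x∈⁅x⁆ z)))
      (prove-≡ (env (S ∷ [])) ((tA :⊆ tN , S⊆N) ∷ (tXY :⊆ tA , XY⊆S) ∷ setup (S ∷ []))
        (tXY :∪ (tZ :∪ tA :∩ tL) :∩ tL) tA))

  z∉∩L : ∀ S → z ∉ S ∩ L
  z∉∩L S z∈ = ∉⊥ (prove-⊆ (env (S ∷ [])) (setup (S ∷ [])) (tZ :∩ tA :∩ tL) :∅
    (x∈p∩q⁺ (x∈⁅x⁆ z , z∈)))

  expand-contract-partial : XY ⊈ S → expand (contract S) ≡ S ∩ L
  expand-contract-partial {S} XY⊈S = ≡.trans (≡.cong expand (contract-partial XY⊈S))
    (≡.trans (expand-∉ (z∉∩L S))
      (prove-≡ (env (S ∷ [])) [] ((tA :∩ tL) :∩ tL) (tA :∩ tL)))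

  contract-L : ∀ S → contract (S ∩ L) ≡ S ∩ L
  contract-L S = ≡.trans (contract-partial (XY⊈∩L S))
    (prove-≡ (env (S ∷ [])) [] ((tA :∩ tL) :∩ tL) (tA :∩ tL))

  XY⊈X : XY ⊈ X
  XY⊈X XY⊆X = x≢y (≡.sym (x∈⁅y⁆⇒x≡y x (XY⊆X y∈XY)))

  XY⊈Y : XY ⊈ Y
  XY⊈Y XY⊆Y = x≢y (x∈⁅y⁆⇒x≡y y (XY⊆Y x∈XY))

  contract-X : contract X ≡ ∅
  contract-X = ≡.trans (contract-partial XY⊈X)
    (prove-≡ (env []) (setup []) (tX :∩ tL) :∅)

  contract-Y : contract Y ≡ ∅
  contract-Y = ≡.trans (contract-partial XY⊈Y)
    (prove-≡ (env []) (setup []) (tY :∩ tL) :∅)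

  contract-XY : contract XY ≡ Z
  contract-XY = ≡.trans (contract-full id)
    (prove-≡ (env []) (setup []) (tZ :∪ tXY :∩ tL) tZ)

  contract-∅ : contract ∅ ≡ ∅
  contract-∅ = ≡.trans (contract-partial λ XY⊆∅ → ∉⊥ (XY⊆∅ x∈XY))
    (prove-≡ (env []) [] (:∅ :∩ tL) :∅)

-- The supermodular differences of a replication

module Replication (ℝ : RealNumbers) {n} (N M : Subset n) (x y z : Fin n)
                   (z∈M : z ∈ M) (L⊆N : M ─ ⁅ z ⁆ ⊆ N)
                   (N─L≡xy : N ─ (M ─ ⁅ z ⁆) ≡ ⁅ x ⁆ ∪ ⁅ y ⁆) (x≢y : x ≢ y) where

  open RealNumbers ℝ hiding (zero)
  open SetFunctions ℝ hiding (Carrier; _≈_; _≤_; _<_; _+_; _*_; _-_; 0#; 1#)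
  open OrderedField ℝ
  open SupermodularCone ℝ
  open Weights ℝ
  open SetSolver
  open Contraction N M x y z z∈M L⊆N N─L≡xy x≢y
  open import Algebra.Properties.Ring ring using (-0#≈0#)
  open import Relation.Binary.Reasoning.Setoid setoid

  private
    variable
      A B C S : Subset n
      m m′ r r′ : SetFunction n

  rep : SetFunction n → SetFunction n
  rep = lowerRep N L z

  rep-contract : ∀ r S → rep r S ≡ r (contract S)
  rep-contract r S = ≡.trans
    (≡.cong (λ Q → if does (Q ⊆? S) then r (Z ∪ (S ∩ L)) else r (S ∩ L)) N─L≡xy)
    (≡.sym (if-float r (does (XY ⊆? S))))

  rep-≡ : ∀ r S {S′} → contract S ≡ S′ → rep r S ≡ r S′
  rep-≡ r S eq = ≡.trans (rep-contract r S) (≡.cong r eq)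

  -- By `Δ-rep-XY` this is itself a value of `Δ (rep r)`, so its sign and its vanishing can be read
  -- off the replication.
  jump : SetFunction n → Carrier
  jump r = r Z - r ∅

  Δ-≡ : ∀ (m : SetFunction n) A B (r : SetFunction n) A′ B′ →
        m (A ∪ B) ≡ r (A′ ∪ B′) → m (A ∩ B) ≡ r (A′ ∩ B′) → m A ≡ r A′ → m B ≡ r B′ → Δ m A B ≈ Δ r A′ B′
  Δ-≡ m A B r A′ B′ ∪≡ ∩≡ A≡ B≡ = +-cong (+-cong (reflexive ∪≡) (reflexive ∩≡))
    (-‿cong (+-cong (reflexive A≡) (reflexive B≡)))

  Δ-rep-regular : ∀ A B → contract (A ∪ B) ≡ contract A ∪ contract B →
                  ∀ r → Δ (rep r) A B ≈ Δ r (contract A) (contract B)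
  Δ-rep-regular A B eq r = Δ-≡ (rep r) A B r (contract A) (contract B)
    (rep-≡ r (A ∪ B) eq) (rep-≡ r (A ∩ B) (contract-∩ A B)) (rep-contract r A) (rep-contract r B)

  -- Here z enters with the union only. It is first adjoined to A ∩ L: this costs r(z ∪ (A ∩ L)) -
  -- r(A ∩ L), which is the bracket since z is not in L. Once z is there, the union behaves
  -- regularly.
  Δ-rep-irregular : ∀ A B → XY ⊈ A → XY ⊈ B → XY ⊆ A ∪ B → ∀ r →
    Δ (rep r) A B ≈ Δ r (Z ∪ (A ∩ L)) (B ∩ L) + (Δ r Z (A ∩ L) + jump r)
  Δ-rep-irregular A B XY⊈A XY⊈B XY⊆A∪B r = begin
    Δ (rep r) A B
      ≈⟨ +-cong (+-cong
           (reflexive (rep-≡ r (A ∪ B) (≡.trans (contract-full XY⊆A∪B) (prove-≡ (env (A ∷ B ∷ [])) []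
             (tZ :∪ (tA :∪ tB) :∩ tL) ((tZ :∪ tA :∩ tL) :∪ tB :∩ tL)))))
           (reflexive (rep-≡ r (A ∩ B) (≡.trans (contract-partial λ h → XY⊈A (p∩q⊆p A B ∘ h))
             (prove-≡ (env (A ∷ B ∷ [])) []
               ((tA :∩ tB) :∩ tL) ((tZ :∪ tA :∩ tL) :∩ tB :∩ tL))))))
         (-‿cong (+-cong (reflexive (rep-≡ r A (contract-partial XY⊈A)))
                         (reflexive (rep-≡ r B (contract-partial XY⊈B))))) ⟩
    (r ((Z ∪ (A ∩ L)) ∪ (B ∩ L)) + r ((Z ∪ (A ∩ L)) ∩ (B ∩ L))) - (r (A ∩ L) + r (B ∩ L))
      ≈⟨ solve 7 (λ u i za a b rz e →
           (u :+ i) :- (a :+ b) :=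
           (u :+ i :- (za :+ b)) :+ ((za :+ e :- (rz :+ a)) :+ (rz :- e)))
         refl _ _ (r (Z ∪ (A ∩ L))) _ _ (r Z) (r ∅) ⟩
    Δ r (Z ∪ (A ∩ L)) (B ∩ L) + (((r (Z ∪ (A ∩ L)) + r ∅) - (r Z + r (A ∩ L))) + jump r)
      ≈⟨ +-congˡ (+-congʳ (+-congʳ (+-congˡ (reflexive (≡.cong r Z∩A∩L≡∅))))) ⟨
    Δ r (Z ∪ (A ∩ L)) (B ∩ L) + (Δ r Z (A ∩ L) + jump r) ∎
    where
    Z∩A∩L≡∅ : Z ∩ (A ∩ L) ≡ ∅
    Z∩A∩L≡∅ = prove-≡ (env (A ∷ [])) [] (tZ :∩ tA :∩ tL) :∅

  -- The sets are chosen before `r`, so that `rep-Tight⊆⁺` can compare two functions at the same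
  -- sets.
  Δ-rep : ∀ A B →
    (∃ λ A′ → ∃ λ B′ → A′ ⊆ M × B′ ⊆ M × (∀ r → Δ (rep r) A B ≈ Δ r A′ B′)) ⊎
    (∃ λ A′ → ∃ λ B′ → ∃ λ C′ → A′ ⊆ M × B′ ⊆ M × C′ ⊆ M ×
      (∀ r → Δ (rep r) A B ≈ Δ r A′ B′ + (Δ r Z C′ + jump r)))
  Δ-rep A B = Sum.map
    (λ eq → contract A , contract B , contract⊆M A , contract⊆M B , Δ-rep-regular A B eq)
    (λ (p , q , h) → Z ∪ (A ∩ L) , B ∩ L , A ∩ L ,
      prove-⊆ (env (A ∷ B ∷ [])) (setup _) (tZ :∪ tA :∩ tL) tM ,
      prove-⊆ (env (A ∷ B ∷ [])) (setup _) (tB :∩ tL) tM ,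
      prove-⊆ (env (A ∷ B ∷ [])) (setup _) (tA :∩ tL) tM ,
      Δ-rep-irregular A B p q h)
    (contract-∪ A B)

  Z⊆M : Z ⊆ M
  Z⊆M = ⁅⁆⊆ z∈M

  X⊆N : X ⊆ N
  X⊆N = prove-⊆ (env []) (setup []) tX tN

  Y⊆N : Y ⊆ N
  Y⊆N = prove-⊆ (env []) (setup []) tY tN

  Δ-rep-expand : ∀ r A B → A ⊆ M → B ⊆ M → Δ (rep r) (expand A) (expand B) ≈ Δ r A B
  Δ-rep-expand r A B A⊆M B⊆M = Δ-≡ (rep r) (expand A) (expand B) r A B
    (≡.trans (≡.cong (rep r) (≡.sym (expand-∪ A B)))
             (rep-≡ r (expand (A ∪ B)) (contract-expand (∪-⊆ A⊆M B⊆M))))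
    (≡.trans (≡.cong (rep r) (≡.sym (expand-∩ A B)))
             (rep-≡ r (expand (A ∩ B)) (contract-expand (∩-⊆ {B = B} A⊆M))))
    (rep-≡ r (expand A) (contract-expand A⊆M)) (rep-≡ r (expand B) (contract-expand B⊆M))

  Δ-rep-XY : ∀ r → Δ (rep r) X Y ≈ jump r
  Δ-rep-XY r = trans
    (+-cong (+-cong (reflexive (rep-≡ r XY contract-XY))
                    (reflexive (rep-≡ r (X ∩ Y) (≡.trans (≡.cong contract X∩Y≡∅) contract-∅))))
            (-‿cong (+-cong (reflexive (rep-≡ r X contract-X)) (reflexive (rep-≡ r Y contract-Y)))))
    (solve 2 (λ a b → (a :+ b) :- (b :+ b) := a :- b) refl (r Z) (r ∅))
    where
    X∩Y≡∅ : X ∩ Y ≡ ∅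
    X∩Y≡∅ = prove-≡ (env []) (setup []) (tX :∩ tY) :∅

  -- Transfer of supermodularity, modularity and tightness

  rep-𝓚⁺ : 𝓚 M r → r ∅ ≤ r Z → 𝓚 N (rep r)
  rep-𝓚⁺ {r = r} rK r∅≤rZ = 0≤Δ⇒𝓚 λ A B _ _ → nonneg A B (Δ-rep A B)
    where
    nonneg : ∀ A B → _ → 0# ≤ Δ (rep r) A B
    nonneg A B (inj₁ (A′ , B′ , A′⊆M , B′⊆M , eq)) =
      ≤-respʳ-≈ (sym (eq r)) (𝓚⇒0≤Δ rK A′ B′ A′⊆M B′⊆M)
    nonneg A B (inj₂ (A′ , B′ , C′ , A′⊆M , B′⊆M , C′⊆M , eq)) =
      ≤-respʳ-≈ (sym (eq r)) (0≤-+ (𝓚⇒0≤Δ rK A′ B′ A′⊆M B′⊆M)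
        (0≤-+ (𝓚⇒0≤Δ rK Z C′ Z⊆M C′⊆M) (≤⇒0≤- r∅≤rZ)))

  rep-𝓚⁻ : 𝓚 N (rep r) → 𝓚 M r × r ∅ ≤ r Z
  rep-𝓚⁻ {r = r} mK =
    (0≤Δ⇒𝓚 λ A B A⊆M B⊆M → ≤-respʳ-≈ (Δ-rep-expand r A B A⊆M B⊆M)
      (𝓚⇒0≤Δ mK _ _ (expand⊆N A) (expand⊆N B))) ,
    0≤-⇒≤ (≤-respʳ-≈ (Δ-rep-XY r) (𝓚⇒0≤Δ mK X Y X⊆N Y⊆N))

  rep-𝓛⁺ : 𝓛 M r → jump r ≈ 0# → 𝓛 N (rep r)
  rep-𝓛⁺ {r = r} rL jump≈0 = Δ≈0⇒𝓛 λ A B _ _ → flat A B (Δ-rep A B)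
    where
    flat : ∀ A B → _ → Δ (rep r) A B ≈ 0#
    flat A B (inj₁ (A′ , B′ , A′⊆M , B′⊆M , eq)) =
      trans (eq r) (𝓛⇒Δ≈0 rL A′ B′ A′⊆M B′⊆M)
    flat A B (inj₂ (A′ , B′ , C′ , A′⊆M , B′⊆M , C′⊆M , eq)) = begin
      Δ (rep r) A B                              ≈⟨ eq r ⟩
      Δ r A′ B′ + (Δ r Z C′ + jump r)            ≈⟨ +-cong (𝓛⇒Δ≈0 rL A′ B′ A′⊆M B′⊆M)
                                                      (+-cong (𝓛⇒Δ≈0 rL Z C′ Z⊆M C′⊆M) jump≈0) ⟩
      0# + (0# + 0#)                             ≈⟨ trans (+-identityˡ _) (+-identityˡ _) ⟩
      0#                                         ∎

  rep-𝓛⁻ : 𝓛 N (rep r) → 𝓛 M r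
  rep-𝓛⁻ {r = r} mL = Δ≈0⇒𝓛 λ A B A⊆M B⊆M →
    trans (sym (Δ-rep-expand r A B A⊆M B⊆M)) (𝓛⇒Δ≈0 mL _ _ (expand⊆N A) (expand⊆N B))

  -- In the irregular case the three summands for `r` are nonnegative, so a vanishing sum makes each
  -- vanish; each equality then passes to `r′` separately.
  rep-Tight⊆⁺ : 𝓚 M r → r ∅ ≤ r Z → Tight⊆ M r r′ → (jump r ≈ 0# → jump r′ ≈ 0#) →
                Tight⊆ N (rep r) (rep r′)
  rep-Tight⊆⁺ {r = r} {r′ = r′} rK r∅≤rZ t j A B _ _ = tight (Δ-rep A B)
    where
    tight : _ → Δ (rep r) A B ≈ 0# → Δ (rep r′) A B ≈ 0#
    tight (inj₁ (A′ , B′ , A′⊆M , B′⊆M , eq)) Δ≈0 =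
      trans (eq r′) (t A′ B′ A′⊆M B′⊆M (trans (sym (eq r)) Δ≈0))
    tight (inj₂ (A′ , B′ , C′ , A′⊆M , B′⊆M , C′⊆M , eq)) Δ≈0 = begin
      Δ (rep r′) A B                               ≈⟨ eq r′ ⟩
      Δ r′ A′ B′ + (Δ r′ Z C′ + jump r′)
        ≈⟨ +-cong (t A′ B′ A′⊆M B′⊆M (0≤-+≈0⇒≈0 0≤₁ (0≤-+ 0≤₂ 0≤₃) sum≈0))
                  (+-cong (t Z C′ Z⊆M C′⊆M (0≤-+≈0⇒≈0 0≤₂ 0≤₃ sum₂₃≈0))
                          (j (0≤-+≈0⇒≈0 0≤₃ 0≤₂ (trans (+-comm _ _) sum₂₃≈0)))) ⟩
      0# + (0# + 0#)                               ≈⟨ trans (+-identityˡ _) (+-identityˡ _) ⟩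
      0#                                           ∎
      where
      0≤₁ = 𝓚⇒0≤Δ rK A′ B′ A′⊆M B′⊆M
      0≤₂ = 𝓚⇒0≤Δ rK Z C′ Z⊆M C′⊆M
      0≤₃ = ≤⇒0≤- r∅≤rZ
      sum≈0 = trans (sym (eq r)) Δ≈0
      sum₂₃≈0 = 0≤-+≈0⇒≈0 (0≤-+ 0≤₂ 0≤₃) 0≤₁ (trans (+-comm _ _) sum≈0)

  rep-Tight⊆⁻ : ∀ r r′ → Tight⊆ N (rep r) (rep r′) → Tight⊆ M r r′
  rep-Tight⊆⁻ r r′ t A B A⊆M B⊆M Δ≈0 = trans (sym (Δ-rep-expand r′ A B A⊆M B⊆M))
    (t _ _ (expand⊆N A) (expand⊆N B) (trans (Δ-rep-expand r A B A⊆M B⊆M) Δ≈0))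

  rep-Tight⊆-jump : ∀ r r′ → Tight⊆ N (rep r) (rep r′) → jump r ≈ 0# → jump r′ ≈ 0#
  rep-Tight⊆-jump r r′ t jump≈0 =
    trans (sym (Δ-rep-XY r′)) (t X Y X⊆N Y⊆N (trans (Δ-rep-XY r) jump≈0))

  -- Subtracting modular functions

  SameΔ : Subset n → SetFunction n → SetFunction n → Set
  SameΔ N m m′ = ∀ A B → A ⊆ N → B ⊆ N → Δ m A B ≈ Δ m′ A B

  SameΔ-𝓚 : ∀ {N} → SameΔ N m m′ → 𝓚 N m → 𝓚 N m′
  SameΔ-𝓚 s mK = 0≤Δ⇒𝓚 λ A B A⊆ B⊆ → ≤-respʳ-≈ (s A B A⊆ B⊆) (𝓚⇒0≤Δ mK A B A⊆ B⊆)

  SameΔ-Tight⊆ : ∀ {N} → SameΔ N m m′ → Tight⊆ N m m′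
  SameΔ-Tight⊆ s A B A⊆ B⊆ Δ≈0 = trans (sym (s A B A⊆ B⊆)) Δ≈0

  SameΔ-sym : ∀ {N} → SameΔ N m m′ → SameΔ N m′ m
  SameΔ-sym s A B A⊆ B⊆ = sym (s A B A⊆ B⊆)

  -- A correction by a modular function that brings the value at z to the value at ∅. All `Δ` stay
  -- the same, and supermodularity now passes to the replication.
  level : SetFunction n → SetFunction n
  level r S = r S - weight z (jump r) S

  level-SameΔ : ∀ r → SameΔ M (level r) r
  level-SameΔ r A B _ _ = trans (Δ-- r _ A B)
    (trans (+-congˡ (trans (-‿cong (Δ-weight z (jump r) A B)) -0#≈0#)) (+-identityʳ _))

  jump-level : ∀ r → jump (level r) ≈ 0#
  jump-level r = trans
    (+-cong (+-congˡ (-‿cong (weight-∈ (x∈⁅x⁆ z))))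
            (-‿cong (+-congˡ (-‿cong (weight-∉ {i = z} ∉⊥)))))
    (solve 3 (λ a b o → a :- (a :- b) :- (b :- o) := o) refl (r Z) (r ∅) 0#)

  jump≈0⇒≤ : jump r ≈ 0# → r ∅ ≤ r Z
  jump≈0⇒≤ j = 0≤-⇒≤ (≤-reflexive (sym j))

  -- A function satisfying all equalities of rep r is itself a replication, up
  -- to the modular function removed in `flatten`.
  module Preimage (r m′ : SetFunction n) (t : Tight⊆ N (rep r) m′) where

    slope : Fin n → Carrier
    slope u = m′ ⁅ u ⁆ - m′ ∅

    -- The weights cancel what x alone, or y alone, adds to a set; a replication must ignore both
    -- contributions.
    flatten : SetFunction n
    flatten S = m′ S - (weight x (slope x) S + weight y (slope y) S)

    preimage : SetFunction n
    preimage = flatten ∘ expand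

    flatten-SameΔ : SameΔ N flatten m′
    flatten-SameΔ A B _ _ = begin
      Δ flatten A B
        ≈⟨ Δ-- m′ _ A B ⟩
      Δ m′ A B - Δ (λ S → weight x (slope x) S + weight y (slope y) S) A B
        ≈⟨ +-congˡ (-‿cong (trans (Δ-+ (weight x (slope x)) _ A B)
             (+-cong (Δ-weight x _ A B) (Δ-weight y _ A B)))) ⟩
      Δ m′ A B - (0# + 0#)
        ≈⟨ solve 2 (λ d o → d :- (o :+ o) := d :- o :- o) refl _ 0# ⟩
      Δ m′ A B - 0# - 0#
        ≈⟨ trans (+-cong (trans (+-congˡ -0#≈0#) (+-identityʳ _)) -0#≈0#) (+-identityʳ _) ⟩
      Δ m′ A B ∎

    -- `rep r` does not notice `u` in a set missing the other point of the pair. Hence the pair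
    -- `⁅ u ⁆`, `S ∩ L` is tight for `rep r`, and by `t` also for `m′`, which leaves only the slope
    -- of `u`.
    peel : ∀ u S → S ⊆ N → contract ⁅ u ⁆ ≡ ∅ → XY ⊈ S →
           S ≡ ⁅ u ⁆ ∪ (S ∩ L) → ⁅ u ⁆ ∩ (S ∩ L) ≡ ∅ →
           m′ S ≈ m′ (S ∩ L) + slope u
    peel u S S⊆N cu≡∅ XY⊈S S≡ u∩S≡∅ = begin
      m′ S
        ≡⟨ ≡.cong m′ S≡ ⟩
      m′ (⁅ u ⁆ ∪ (S ∩ L))
        ≈⟨ solve 4 (λ a e s b → a := (a :+ e :- (s :+ b)) :+ (b :+ (s :- e))) refl
             _ (m′ ∅) (m′ ⁅ u ⁆) (m′ (S ∩ L)) ⟩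
      _ + (m′ (S ∩ L) + slope u)
        ≈⟨ +-congʳ (+-congʳ (+-congˡ (reflexive (≡.cong m′ u∩S≡∅)))) ⟨
      Δ m′ ⁅ u ⁆ (S ∩ L) + (m′ (S ∩ L) + slope u)
        ≈⟨ +-congʳ (t ⁅ u ⁆ (S ∩ L) u⊆N S∩L⊆N rep-tight) ⟩
      0# + (m′ (S ∩ L) + slope u)
        ≈⟨ +-identityˡ _ ⟩
      m′ (S ∩ L) + slope u ∎
      where
      u⊆N : ⁅ u ⁆ ⊆ N
      u⊆N i∈u = S⊆N (≡.subst (_ ∈_) (≡.sym S≡) (p⊆p∪q (S ∩ L) i∈u))

      S∩L⊆N : S ∩ L ⊆ N
      S∩L⊆N = L⊆N ∘ p∩q⊆q S L

      rep-tight : Δ (rep r) ⁅ u ⁆ (S ∩ L) ≈ 0#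
      rep-tight = trans
        (+-cong (+-cong (reflexive (≡.trans (≡.cong (rep r) (≡.sym S≡))
                                            (rep-≡ r S (contract-partial XY⊈S))))
                        (reflexive (≡.trans (≡.cong (rep r) u∩S≡∅) (rep-≡ r ∅ contract-∅))))
                (-‿cong (+-cong (reflexive (rep-≡ r ⁅ u ⁆ cu≡∅))
                                (reflexive (rep-≡ r (S ∩ L) (contract-L S))))))
        (trans (+-congˡ (-‿cong (+-comm _ _))) (-‿inverseʳ _))

    x∉∩L : x ∉ S ∩ L
    x∉∩L {S} x∈ = ∉⊥ (prove-⊆ (env (S ∷ [])) (setup (S ∷ [])) (tX :∩ tA :∩ tL) :∅
      (x∈p∩q⁺ (x∈⁅x⁆ x , x∈)))

    y∉∩L : y ∉ S ∩ L
    y∉∩L {S} y∈ = ∉⊥ (prove-⊆ (env (S ∷ [])) (setup (S ∷ [])) (tY :∩ tA :∩ tL) :∅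
      (x∈p∩q⁺ (x∈⁅x⁆ y , y∈)))

    flatten-value : ∀ S {a b} → weight x (slope x) S ≈ a → weight y (slope y) S ≈ b →
                    m′ S ≈ m′ (S ∩ L) + (a + b) → flatten S ≈ m′ (S ∩ L)
    flatten-value S {a} {b} x≈a y≈b m′S≈ = trans
      (+-cong m′S≈ (-‿cong (+-cong x≈a y≈b)))
      (solve 2 (λ p q → p :+ q :- q := p) refl (m′ (S ∩ L)) (a + b))

    flatten-L : ∀ S → flatten (S ∩ L) ≈ m′ (S ∩ L)
    flatten-L S = trans
      (flatten-value (S ∩ L) (weight-∉ x∉∩L) (weight-∉ y∉∩L)
        (trans (reflexive (≡.cong m′ (≡.sym L-idem)))
               (sym (trans (+-congˡ (+-identityˡ 0#)) (+-identityʳ _)))))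
      (reflexive (≡.cong m′ L-idem))
      where
      L-idem : (S ∩ L) ∩ L ≡ S ∩ L
      L-idem = prove-≡ (env (S ∷ [])) [] ((tA :∩ tL) :∩ tL) (tA :∩ tL)

    flatten-partial : ∀ S → S ⊆ N → XY ⊈ S → flatten S ≈ m′ (S ∩ L)
    flatten-partial S S⊆N XY⊈S = by-cases (x ∈? S) (y ∈? S)
      where
      by-cases : Dec (x ∈ S) → Dec (y ∈ S) → flatten S ≈ m′ (S ∩ L)
      by-cases (yes x∈S) (yes y∈S) = ⊥-elim (XY⊈S (∪-⊆ (⁅⁆⊆ x∈S) (⁅⁆⊆ y∈S)))
      by-cases (yes x∈S) (no y∉S) = flatten-value S (weight-∈ x∈S) (weight-∉ y∉S)
        (trans (peel x S S⊆N contract-X XY⊈S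
                  (prove-≡ (env (S ∷ []))
                    ((tA :⊆ tN , S⊆N) ∷ (tX :⊆ tA , ⁅⁆⊆ x∈S) ∷ (tY :∩ tA :⊆ :∅ , ⁅⁆∩⊆∅ y∉S) ∷
                     setup (S ∷ []))
                    tA (tX :∪ tA :∩ tL))
                  (prove-≡ (env (S ∷ [])) (setup (S ∷ [])) (tX :∩ tA :∩ tL) :∅))
               (+-congˡ (sym (+-identityʳ _))))
      by-cases (no x∉S) (yes y∈S) = flatten-value S (weight-∉ x∉S) (weight-∈ y∈S)
        (trans (peel y S S⊆N contract-Y XY⊈S
                  (prove-≡ (env (S ∷ []))
                    ((tA :⊆ tN , S⊆N) ∷ (tX :∩ tA :⊆ :∅ , ⁅⁆∩⊆∅ x∉S) ∷ (tY :⊆ tA , ⁅⁆⊆ y∈S) ∷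
                     setup (S ∷ []))
                    tA (tY :∪ tA :∩ tL))
                  (prove-≡ (env (S ∷ [])) (setup (S ∷ [])) (tY :∩ tA :∩ tL) :∅))
               (+-congˡ (sym (+-identityˡ _))))
      by-cases (no x∉S) (no y∉S) = flatten-value S (weight-∉ x∉S) (weight-∉ y∉S)
        (trans (reflexive (≡.cong m′ (prove-≡ (env (S ∷ []))
                    ((tA :⊆ tN , S⊆N) ∷ (tX :∩ tA :⊆ :∅ , ⁅⁆∩⊆∅ x∉S) ∷
                     (tY :∩ tA :⊆ :∅ , ⁅⁆∩⊆∅ y∉S) ∷ setup (S ∷ []))
                    tA (tA :∩ tL))))
               (sym (trans (+-congˡ (+-identityˡ 0#)) (+-identityʳ _))))

    -- `expand` undoes `contract` on sets containing both x and y. On the others the round trip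
    -- gives `S ∩ L`, where `flatten` has the same value as at `S`.
    rep-preimage : ∀ S → S ⊆ N → rep preimage S ≈ flatten S
    rep-preimage S S⊆N with XY ⊆? S
    ... | yes XY⊆S = reflexive (≡.trans (rep-contract preimage S)
      (≡.cong flatten (expand-contract-full S⊆N XY⊆S)))
    ... | no XY⊈S  = trans
      (reflexive (≡.trans (rep-contract preimage S)
        (≡.cong flatten (expand-contract-partial XY⊈S))))
      (trans (flatten-L S) (sym (flatten-partial S S⊆N XY⊈S)))

    rep-preimage-SameΔ : SameΔ N (rep preimage) m′
    rep-preimage-SameΔ A B A⊆N B⊆N = trans
      (+-cong (+-cong (rep-preimage _ (∪-⊆ A⊆N B⊆N)) (rep-preimage _ (∩-⊆ {B = B} A⊆N)))
              (-‿cong (+-cong (rep-preimage A A⊆N) (rep-preimage B B⊆N))))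
      (flatten-SameΔ A B A⊆N B⊆N)

  -- Extreme functions

  -- A competitor `m′` is exchanged for `rep s`. The pair X, Y is tight for `rep r`, which forces
  -- `jump s ≈ 0#`; so modularity of `s` lifts to `rep s`, while equalities of `s` shared by `r`
  -- lift to the replications.
  rep-TightMaximal⁺ : jump r ≈ 0# → TightMaximal M r → TightMaximal N (rep r)
  rep-TightMaximal⁺ {r = r} jump≈0 (rK , r∉𝓛 , maximal) =
    rep-𝓚⁺ rK (jump≈0⇒≤ {r = r} jump≈0) , r∉𝓛 ∘ rep-𝓛⁻ {r = r} , rep-maximal
    where
    rep-maximal : ∀ m′ → 𝓚 N m′ → Tight⊆ N (rep r) m′ → 𝓛 N m′ ⊎ Tight⊆ N m′ (rep r)
    rep-maximal m′ m′K t = Sum.map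
      (λ sL → 𝓛-Tight⊆ {m = rep s} (rep-𝓛⁺ {r = s} sL jumpₛ≈0)
        (SameΔ-Tight⊆ {m = rep s} {m′ = m′} same))
      (λ t′ → Tight⊆-trans {m = m′} {m′ = rep s} {m″ = rep r} m′⊆rep
        (rep-Tight⊆⁺ sK (jump≈0⇒≤ {r = s} jumpₛ≈0) t′ λ _ → jump≈0))
      (maximal s sK (rep-Tight⊆⁻ r s rep-t))
      where
      open Preimage r m′ t renaming (preimage to s; rep-preimage-SameΔ to same)

      same⁻¹ : SameΔ N m′ (rep s)
      same⁻¹ = SameΔ-sym {m = rep s} {m′ = m′} same

      m′⊆rep : Tight⊆ N m′ (rep s)
      m′⊆rep = SameΔ-Tight⊆ {m = m′} {m′ = rep s} same⁻¹

      rep-t : Tight⊆ N (rep r) (rep s)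
      rep-t = Tight⊆-trans {m = rep r} {m′ = m′} {m″ = rep s} t m′⊆rep

      sK : 𝓚 M s
      sK = proj₁ (rep-𝓚⁻ {r = s} (SameΔ-𝓚 {m = m′} {m′ = rep s} same⁻¹ m′K))

      jumpₛ≈0 : jump s ≈ 0#
      jumpₛ≈0 = rep-Tight⊆-jump r s rep-t jump≈0

  level-Tight⊆ˡ : ∀ r → Tight⊆ M (level r) r
  level-Tight⊆ˡ r = SameΔ-Tight⊆ {m = level r} {m′ = r} (level-SameΔ r)

  level-Tight⊆ʳ : ∀ r → Tight⊆ M r (level r)
  level-Tight⊆ʳ r = SameΔ-Tight⊆ {m = r} {m′ = level r}
    (SameΔ-sym {m = level r} {m′ = r} (level-SameΔ r))

  -- rep r is compared with rep (level r′) because rep r′ itself need not be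
  -- supermodular.
  rep-maximal-level : TightMaximal N (rep r) → ∀ r′ → 𝓚 M r′ → Tight⊆ M r r′ →
                      𝓛 M r′ ⊎ Tight⊆ N (rep (level r′)) (rep r)
  rep-maximal-level {r = r} (mK , _ , maximal) r′ r′K t = Sum.map
    (λ mL → 𝓛-Tight⊆ {m = level r′} (rep-𝓛⁻ {r = level r′} mL) (level-Tight⊆ˡ r′))
    id
    (maximal (rep (level r′))
      (rep-𝓚⁺ levelK (jump≈0⇒≤ {r = level r′} (jump-level r′)))
      (rep-Tight⊆⁺ (proj₁ rK) (proj₂ rK)
        (Tight⊆-trans {m = r} {m′ = r′} {m″ = level r′} t (level-Tight⊆ʳ r′))
        λ _ → jump-level r′))
    where
    rK = rep-𝓚⁻ {r = r} mK

    levelK : 𝓚 M (level r′)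
    levelK = SameΔ-𝓚 {m = r′} {m′ = level r′}
      (SameΔ-sym {m = level r′} {m′ = r′} (level-SameΔ r′)) r′K

  rep-TightMaximal⁻ : jump r ≈ 0# → TightMaximal N (rep r) → TightMaximal M r
  rep-TightMaximal⁻ {r = r} jump≈0 mM@(mK , m∉𝓛 , _) =
    proj₁ (rep-𝓚⁻ {r = r} mK) , (λ rL → m∉𝓛 (rep-𝓛⁺ {r = r} rL jump≈0)) ,
    λ r′ r′K t → Sum.map id
      (λ t′ → Tight⊆-trans {m = r′} {m′ = level r′} {m″ = r}
        (level-Tight⊆ʳ r′) (rep-Tight⊆⁻ (level r′) r t′))
      (rep-maximal-level {r = r} mM r′ r′K t)

  -- The competitor is `level r`: its replication is tight at X, Y and `rep r` is not, so maximality
  -- leaves only the modular alternative.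
  rep-TightMaximal⇒𝓛 : ¬ (jump r ≈ 0#) → TightMaximal N (rep r) → 𝓛 M r
  rep-TightMaximal⇒𝓛 {r = r} jump≉0 mM = Sum.fromInj₁ absurd
    (rep-maximal-level {r = r} mM r (proj₁ (rep-𝓚⁻ {r = r} (proj₁ mM))) λ _ _ _ _ h → h)
    where
    absurd : Tight⊆ N (rep (level r)) (rep r) → 𝓛 M r
    absurd t = ⊥-elim (jump≉0 (rep-Tight⊆-jump (level r) r t (jump-level r)))

  Extreme-rep⁺ : jump r ≈ 0# → Extreme M r → Extreme N (rep r)
  Extreme-rep⁺ {r = r} jump≈0 rE =
    TightMaximal⇒Extreme {m = rep r}
      (rep-TightMaximal⁺ {r = r} jump≈0 (Extreme⇒TightMaximal {m = r} rE))

  Extreme-rep⁻ : jump r ≈ 0# → Extreme N (rep r) → Extreme M r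
  Extreme-rep⁻ {r = r} jump≈0 mE =
    TightMaximal⇒Extreme {m = r}
      (rep-TightMaximal⁻ {r = r} jump≈0 (Extreme⇒TightMaximal {m = rep r} mE))

  rep-𝓚ℓ : 𝓚ℓ M r → 𝓚ℓ N (rep r)
  rep-𝓚ℓ {r = r} (rK , r∅≈0 , r⁅⁆≈0) =
    rep-𝓚⁺ {r = r} rK (≤-reflexive (trans r∅≈0 (sym (r⁅⁆≈0 z z∈M)))) ,
    trans (reflexive (rep-≡ r ∅ contract-∅)) r∅≈0 ,
    λ i _ → trans (reflexive (rep-≡ r ⁅ i ⁆ (contract-partial (XY⊈⁅⁆ i)))) (singleton i)
    where
    XY⊈⁅⁆ : ∀ i → XY ⊈ ⁅ i ⁆
    XY⊈⁅⁆ i XY⊆ = x≢y (≡.trans (x∈⁅y⁆⇒x≡y i (XY⊆ x∈XY)) (≡.sym (x∈⁅y⁆⇒x≡y i (XY⊆ y∈XY))))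

    singleton : ∀ i → r (⁅ i ⁆ ∩ L) ≈ 0#
    singleton i with i ∈? L
    ... | yes i∈L = trans (reflexive (≡.cong r (prove-≡ (env (⁅ i ⁆ ∷ []))
        ((tA :⊆ tL , ⁅⁆⊆ i∈L) ∷ []) (tA :∩ tL) tA))) (r⁅⁆≈0 i (p─q⊆p M Z i∈L))
    ... | no i∉L = trans (reflexive (≡.cong r (prove-≡ (env (⁅ i ⁆ ∷ []))
        ((tA :∩ tL :⊆ :∅ , ⁅⁆∩⊆∅ i∉L) ∷ []) (tA :∩ tL) :∅))) r∅≈0

  𝓛-≗ : (∀ S → S ⊆ N → m S ≈ m′ S) → 𝓛 N m → 𝓛 N m′
  𝓛-≗ m≈m′ mL A B A⊆N B⊆N = trans
    (sym (+-cong (m≈m′ A A⊆N) (m≈m′ B B⊆N)))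
    (trans (mL A B A⊆N B⊆N)
           (+-cong (m≈m′ _ (∪-⊆ A⊆N B⊆N)) (m≈m′ _ (∩-⊆ {B = B} A⊆N))))

  -- Replication commutes with subtraction, and `r` minus its lower standardization is modular with
  -- zero jump.
  rep-≈lowerStd : jump r ≈ 0# → QuantEquiv N (rep r) (rep (lowerStd r))
  rep-≈lowerStd {r = r} jump≈0 = 𝓛-≗ {m = rep difference}
    (λ S _ → reflexive (≡.trans (rep-contract difference S)
      (≡.sym (≡.cong₂ _-_ (rep-contract r S) (rep-contract (lowerStd r) S)))))
    (rep-𝓛⁺ {r = difference} differenceL jump-difference)
    where
    difference : SetFunction n
    difference S = r S - lowerStd r S

    differenceL : 𝓛 M difference
    differenceL = Δ≈0⇒𝓛 λ A B _ _ → trans (Δ-- r (lowerStd r) A B)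
      (x≈y⇒x-y≈0 (sym (Δ-lowerStd r A B)))

    jump-difference : jump difference ≈ 0#
    jump-difference = trans
      (+-cong (+-congˡ (-‿cong (lowerStd-⁅⁆ r z))) (-‿cong (+-congˡ (-‿cong (lowerStd-∅ r)))))
      (trans (solve 3 (λ a b o → a :- o :- (b :- o) := a :- b) refl (r Z) (r ∅) 0#) jump≈0)

  -- The weight at z becomes, after `contract`, a multiple of the indicator of containing `XY`.
  -- Subtracting it from `rep r` gives the replication of the modular function `level r`.
  rep-𝓛≈indicator : 𝓛 M r → QuantEquiv N (rep r) (λ S → (r Z - r ∅) * indicator⊇ XY S)
  rep-𝓛≈indicator {r = r} rL = 𝓛-≗ {m = rep (level r)} value
    (rep-𝓛⁺ {r = level r} (𝓛-Tight⊆ {m = r} rL (level-Tight⊆ʳ r)) (jump-level r))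
    where
    weight-contract : ∀ S → weight z (jump r) (contract S) ≈ jump r * indicator⊇ XY S
    weight-contract S with XY ⊆? S
    ... | yes _ = trans (weight-∈ (p⊆p∪q (S ∩ L) (x∈⁅x⁆ z))) (sym (*-identityʳ _))
    ... | no _  = trans (weight-∉ (z∉∩L S)) (sym (zeroʳ _))

    value : ∀ S → S ⊆ N → rep (level r) S ≈ rep r S - (r Z - r ∅) * indicator⊇ XY S
    value S _ = trans (reflexive (rep-contract (level r) S))
      (+-cong (reflexive (≡.sym (rep-contract r S))) (-‿cong (weight-contract S)))

  -- Independency statements

  Indep-≡ : ∀ (m : SetFunction n) A B C (r : SetFunction n) A′ B′ C′ →
            m (A ∪ B ∪ C) ≡ r (A′ ∪ B′ ∪ C′) → m C ≡ r C′ →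
            m (A ∪ C) ≡ r (A′ ∪ C′) → m (B ∪ C) ≡ r (B′ ∪ C′) →
            Indep m A B C ⇔ Indep r A′ B′ C′
  Indep-≡ m A B C r A′ B′ C′ e₁ e₂ e₃ e₄
    rewrite e₁ | e₂ | e₃ | e₄ = mk⇔ id id

  Indep-swap : ∀ (m : SetFunction n) A B C → Indep m A B C → Indep m B A C
  Indep-swap m A B C h = trans
    (+-congʳ (+-congʳ (+-congʳ (reflexive (≡.cong m BAC≡ABC)))))
    (trans (solve 4 (λ u c a b → u :+ c :- b :- a := u :+ c :- a :- b) refl _ _ _ _) h)
    where
    BAC≡ABC : B ∪ A ∪ C ≡ A ∪ B ∪ C
    BAC≡ABC = prove-≡ (env (A ∷ B ∷ C ∷ [])) [] (tB :∪ tA :∪ tC) (tA :∪ tB :∪ tC)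

  Indep-rep-outside : ∀ r A B C → Nonempty (XY ─ (A ∪ B ∪ C)) →
    Indep (rep r) A B C ⇔ Indep r (A ∩ L) (B ∩ L) (C ∩ L)
  Indep-rep-outside r A B C (i , i∈) = Indep-≡ (rep r) A B C r (A ∩ L) (B ∩ L) (C ∩ L)
    (value (A ∪ B ∪ C) id (prove-≡ ρ [] ((tA :∪ tB :∪ tC) :∩ tL) (tA :∩ tL :∪ tB :∩ tL :∪ tC :∩ tL)))
    (value C (prove-⊆ ρ [] tC (tA :∪ tB :∪ tC)) ≡.refl)
    (value (A ∪ C) (prove-⊆ ρ [] (tA :∪ tC) (tA :∪ tB :∪ tC))
      (prove-≡ ρ [] ((tA :∪ tC) :∩ tL) (tA :∩ tL :∪ tC :∩ tL)))
    (value (B ∪ C) (prove-⊆ ρ [] (tB :∪ tC) (tA :∪ tB :∪ tC))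
      (prove-≡ ρ [] ((tB :∪ tC) :∩ tL) (tB :∩ tL :∪ tC :∩ tL)))
    where
    ρ = env (A ∷ B ∷ C ∷ [])

    value : ∀ S {S′} → S ⊆ A ∪ B ∪ C → S ∩ L ≡ S′ → rep r S ≡ r S′
    value S S⊆ eq = rep-≡ r S (≡.trans (contract-partial λ XY⊆S →
      ∉⊥ (prove-⊆ ρ [] ((tXY :─ (tA :∪ tB :∪ tC)) :∩ (tA :∪ tB :∪ tC)) :∅
        (x∈p∩q⁺ (i∈ , S⊆ (XY⊆S (p─q⊆p XY (A ∪ B ∪ C) i∈)))))) eq)

  Indep-rep-inside : ∀ r A B C → A ⊆ N → B ⊆ N → A ∩ C ⊆ ∅ → B ∩ C ⊆ ∅ → XY ⊆ C →
    Indep (rep r) A B C ⇔ Indep r A B (Z ∪ (C ∩ L))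
  Indep-rep-inside r A B C A⊆N B⊆N A∩C B∩C XY⊆C = Indep-≡ (rep r) A B C r A B (Z ∪ (C ∩ L))
    (value (A ∪ B ∪ C) (prove-⊆ ρ [] tC (tA :∪ tB :∪ tC))
      (prove-≡ ρ facts (tZ :∪ (tA :∪ tB :∪ tC) :∩ tL) (tA :∪ tB :∪ tZ :∪ tC :∩ tL)))
    (value C id ≡.refl)
    (value (A ∪ C) (prove-⊆ ρ [] tC (tA :∪ tC))
      (prove-≡ ρ facts (tZ :∪ (tA :∪ tC) :∩ tL) (tA :∪ tZ :∪ tC :∩ tL)))
    (value (B ∪ C) (prove-⊆ ρ [] tC (tB :∪ tC))
      (prove-≡ ρ facts (tZ :∪ (tB :∪ tC) :∩ tL) (tB :∪ tZ :∪ tC :∩ tL)))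
    where
    ρ = env (A ∷ B ∷ C ∷ [])

    facts : List (Fact ρ)
    facts = (tA :⊆ tN , A⊆N) ∷ (tB :⊆ tN , B⊆N) ∷ (tA :∩ tC :⊆ :∅ , A∩C) ∷
            (tB :∩ tC :⊆ :∅ , B∩C) ∷ (tXY :⊆ tC , XY⊆C) ∷ setup _

    value : ∀ S {S′} → C ⊆ S → Z ∪ (S ∩ L) ≡ S′ → rep r S ≡ r S′
    value S C⊆S eq = rep-≡ r S (≡.trans (contract-full (C⊆S ∘ XY⊆C)) eq)

  -- `C` lacks part of the pair and `A` completes it, so adjoining `A` is what makes z appear: `A`
  -- plays the role of z. As `A` misses L and `B` lies in L, `(A ∪ B) ∩ L` is just `B`, in a form
  -- symmetric in the two sets.
  Indep-rep-half : ∀ r A B C → A ⊆ XY → B ⊆ N → B ∩ (A ∪ C) ⊆ ∅ → XY ⊆ A ∪ C → XY ⊈ B ∪ C →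
    Indep (rep r) A B C ⇔ Indep r Z ((A ∪ B) ∩ L) (C ∩ L)
  Indep-rep-half r A B C A⊆XY B⊆N disjoint XY⊆A∪C XY⊈B∪C =
    Indep-≡ (rep r) A B C r Z ((A ∪ B) ∩ L) (C ∩ L)
    (rep-≡ r (A ∪ B ∪ C) (≡.trans
      (contract-full (prove-⊆ ρ facts tXY (tA :∪ tB :∪ tC)))
      (prove-≡ ρ facts (tZ :∪ (tA :∪ tB :∪ tC) :∩ tL) (tZ :∪ (tA :∪ tB) :∩ tL :∪ tC :∩ tL))))
    (rep-≡ r C (contract-partial λ XY⊆C → XY⊈B∪C (q⊆p∪q B C ∘ XY⊆C)))
    (rep-≡ r (A ∪ C) (≡.trans (contract-full XY⊆A∪C)
      (prove-≡ ρ facts (tZ :∪ (tA :∪ tC) :∩ tL) (tZ :∪ tC :∩ tL))))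
    (rep-≡ r (B ∪ C) (≡.trans (contract-partial XY⊈B∪C)
      (prove-≡ ρ facts ((tB :∪ tC) :∩ tL) ((tA :∪ tB) :∩ tL :∪ tC :∩ tL))))
    where
    ρ = env (A ∷ B ∷ C ∷ [])

    facts : List (Fact ρ)
    facts = (tA :⊆ tXY , A⊆XY) ∷ (tB :⊆ tN , B⊆N) ∷ (tB :∩ (tA :∪ tC) :⊆ :∅ , disjoint) ∷
            (tXY :⊆ tA :∪ tC , XY⊆A∪C) ∷ setup _

  -- Only the full union contains `XY`; the other three sets contract to `C`, and one copy of r(C)
  -- cancels.
  Indep-rep-pair : ∀ r A B C → C ⊆ L → XY ⊆ A ∪ B → A ⊆ XY → B ⊆ XY →
    XY ⊈ A ∪ C → XY ⊈ B ∪ C → Indep (rep r) A B C ⇔ (r (Z ∪ C) ≈ r C)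
  Indep-rep-pair r A B C C⊆L XY⊆A∪B A⊆XY B⊆XY XY⊈A∪C XY⊈B∪C = mk⇔
    (λ h → x-y≈0⇒x≈y (trans (sym difference) h))
    (λ eq → trans difference (x≈y⇒x-y≈0 eq))
    where
    ρ = env (A ∷ B ∷ C ∷ [])

    facts : List (Fact ρ)
    facts = (tC :⊆ tL , C⊆L) ∷ (tXY :⊆ tA :∪ tB , XY⊆A∪B) ∷ (tA :⊆ tXY , A⊆XY) ∷
            (tB :⊆ tXY , B⊆XY) ∷ setup _

    difference : ((rep r (A ∪ B ∪ C) + rep r C) - rep r (A ∪ C)) - rep r (B ∪ C) ≈ r (Z ∪ C) - r C
    difference = trans
      (+-cong (+-cong (+-cong
        (reflexive (rep-≡ r (A ∪ B ∪ C) (≡.trans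
          (contract-full (prove-⊆ ρ facts tXY (tA :∪ tB :∪ tC)))
          (prove-≡ ρ facts (tZ :∪ (tA :∪ tB :∪ tC) :∩ tL) (tZ :∪ tC)))))
        (reflexive (rep-≡ r C (≡.trans
          (contract-partial λ XY⊆C → XY⊈A∪C (q⊆p∪q A C ∘ XY⊆C))
          (prove-≡ ρ facts (tC :∩ tL) tC)))))
        (-‿cong (reflexive (rep-≡ r (A ∪ C) (≡.trans (contract-partial XY⊈A∪C)
          (prove-≡ ρ facts ((tA :∪ tC) :∩ tL) tC))))))
        (-‿cong (reflexive (rep-≡ r (B ∪ C) (≡.trans (contract-partial XY⊈B∪C)
          (prove-≡ ρ facts ((tB :∪ tC) :∩ tL) tC))))))
      (solve 2 (λ u c → u :+ c :- c :- c := u :- c) refl _ _)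

  module Triplet (r : SetFunction n) (a b : Fin n) (C : Subset n)
                 (a∈N : a ∈ N) (b∈N : b ∈ N) (a≢b : a ≢ b) (C⊆ : C ⊆ N ─ (⁅ a ⁆ ∪ ⁅ b ⁆)) where

    ρ = env (⁅ a ⁆ ∷ ⁅ b ⁆ ∷ C ∷ [])

    facts : List (Fact ρ)
    facts = (tA :⊆ tN , ⁅⁆⊆ a∈N) ∷ (tB :⊆ tN , ⁅⁆⊆ b∈N) ∷
            (tA :∩ tB :⊆ :∅ , ⁅⁆∩⊆∅ (x≢y⇒x∉⁅y⁆ a≢b)) ∷
            (tC :⊆ tN :─ (tA :∪ tB) , C⊆) ∷ []

    a∉b∪C : a ∉ ⁅ b ⁆ ∪ C
    a∉b∪C a∈ = ∉⊥ (prove-⊆ ρ facts (tA :∩ (tB :∪ tC)) :∅ (x∈p∩q⁺ (x∈⁅x⁆ a , a∈)))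

    b∉a∪C : b ∉ ⁅ a ⁆ ∪ C
    b∉a∪C b∈ = ∉⊥ (prove-⊆ ρ facts (tB :∩ (tA :∪ tC)) :∅ (x∈p∩q⁺ (x∈⁅x⁆ b , b∈)))

    inside-case : XY ⊆ C → Indep (rep r) ⁅ a ⁆ ⁅ b ⁆ C ⇔ Indep r ⁅ a ⁆ ⁅ b ⁆ (Z ∪ (C ∩ L))
    inside-case = Indep-rep-inside r ⁅ a ⁆ ⁅ b ⁆ C (⁅⁆⊆ a∈N) (⁅⁆⊆ b∈N)
      (prove-⊆ ρ facts (tA :∩ tC) :∅) (prove-⊆ ρ facts (tB :∩ tC) :∅)

    -- `w` is the point of the pair outside `C`, hence `a` or `b`. The case of `b` reduces to that
    -- of `a` by symmetry of independence.
    half-case′ : ∀ w → w ∈ XY → w ∉ C → XY ⊆ ⁅ w ⁆ ∪ C → w ∈ ⁅ a ⁆ ∪ ⁅ b ⁆ ∪ C →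
      Indep (rep r) ⁅ a ⁆ ⁅ b ⁆ C ⇔ Indep r Z ((⁅ a ⁆ ∪ ⁅ b ⁆) ∩ L) (C ∩ L)
    half-case′ w w∈XY w∉C XY⊆ w∈ with x∈p∪q⁻ ⁅ a ⁆ (⁅ b ⁆ ∪ C) w∈
    ... | inj₁ w∈a with ≡.refl ← x∈⁅y⁆⇒x≡y a w∈a =
      Indep-rep-half r ⁅ a ⁆ ⁅ b ⁆ C (⁅⁆⊆ w∈XY) (⁅⁆⊆ b∈N)
        (prove-⊆ ρ facts (tB :∩ (tA :∪ tC)) :∅) XY⊆ λ h → a∉b∪C (h w∈XY)
    ... | inj₂ w∈b∪C with x∈p∪q⁻ ⁅ b ⁆ C w∈b∪C
    ...   | inj₂ w∈C = ⊥-elim (w∉C w∈C)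
    ...   | inj₁ w∈b with ≡.refl ← x∈⁅y⁆⇒x≡y b w∈b = mk⇔
      (λ h → ≡.subst goal b∪a≡a∪b (Equivalence.to half (Indep-swap (rep r) ⁅ a ⁆ ⁅ b ⁆ C h)))
      (λ h → Indep-swap (rep r) ⁅ b ⁆ ⁅ a ⁆ C
        (Equivalence.from half (≡.subst goal (≡.sym b∪a≡a∪b) h)))
      where
      goal : Subset n → Set
      goal S = Indep r Z (S ∩ L) (C ∩ L)

      b∪a≡a∪b : ⁅ b ⁆ ∪ ⁅ a ⁆ ≡ ⁅ a ⁆ ∪ ⁅ b ⁆
      b∪a≡a∪b = ∪-comm ⁅ b ⁆ ⁅ a ⁆

      half : Indep (rep r) ⁅ b ⁆ ⁅ a ⁆ C ⇔ goal (⁅ b ⁆ ∪ ⁅ a ⁆)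
      half = Indep-rep-half r ⁅ b ⁆ ⁅ a ⁆ C (⁅⁆⊆ w∈XY) (⁅⁆⊆ a∈N)
        (prove-⊆ ρ facts (tA :∩ (tB :∪ tC)) :∅) XY⊆ λ h → b∉a∪C (h w∈XY)

    half-case : ∣ XY ∩ C ∣ ≡ 1 → XY ⊆ ⁅ a ⁆ ∪ ⁅ b ⁆ ∪ C →
      Indep (rep r) ⁅ a ⁆ ⁅ b ⁆ C ⇔ Indep r Z ((⁅ a ⁆ ∪ ⁅ b ⁆) ∩ L) (C ∩ L)
    half-case size XY⊆ with x ∈? C | y ∈? C
    ... | yes x∈C | yes y∈C = ⊥-elim (x≢y (∣p∣≡1⇒unique size
      (x∈p∩q⁺ (x∈XY , x∈C)) (x∈p∩q⁺ (y∈XY , y∈C))))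
    ... | yes x∈C | no y∉C  = half-case′ y y∈XY y∉C
      (∪-⊆ (q⊆p∪q Y C ∘ ⁅⁆⊆ x∈C) (p⊆p∪q C)) (XY⊆ y∈XY)
    ... | no x∉C  | yes y∈C = half-case′ x x∈XY x∉C
      (∪-⊆ (p⊆p∪q C) (q⊆p∪q X C ∘ ⁅⁆⊆ y∈C)) (XY⊆ x∈XY)
    ... | no x∉C  | no y∉C  = contradiction
      (≡.trans (≡.sym size) (≡.trans (≡.cong ∣_∣ XY∩C≡∅) (∣⊥∣≡0 n))) λ ()
      where
      XY∩C≡∅ : XY ∩ C ≡ ∅
      XY∩C≡∅ = prove-≡ ρ
        ((tX :∩ tC :⊆ :∅ , ⁅⁆∩⊆∅ x∉C) ∷ (tY :∩ tC :⊆ :∅ , ⁅⁆∩⊆∅ y∉C) ∷ []) (tXY :∩ tC) :∅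

    pair-case : XY ≡ ⁅ a ⁆ ∪ ⁅ b ⁆ → Indep (rep r) ⁅ a ⁆ ⁅ b ⁆ C ⇔ (r (Z ∪ C) ≈ r C)
    pair-case eq = Indep-rep-pair r ⁅ a ⁆ ⁅ b ⁆ C
      (prove-⊆ ρ ((tC :⊆ tN :─ (tA :∪ tB) , C⊆) ∷ (tXY :⊆ tA :∪ tB , XY⊆) ∷ setup _) tC tL)
      XY⊆ (ab⊆ ∘ p⊆p∪q ⁅ b ⁆) (ab⊆ ∘ q⊆p∪q ⁅ a ⁆ ⁅ b ⁆)
      (λ h → b∉a∪C (h (ab⊆ (q⊆p∪q ⁅ a ⁆ ⁅ b ⁆ (x∈⁅x⁆ b)))))
      (λ h → a∉b∪C (h (ab⊆ (p⊆p∪q ⁅ b ⁆ (x∈⁅x⁆ a)))))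
      where
      XY⊆ : XY ⊆ ⁅ a ⁆ ∪ ⁅ b ⁆
      XY⊆ = ≡.subst (XY ⊆_) eq id

      ab⊆ : ⁅ a ⁆ ∪ ⁅ b ⁆ ⊆ XY
      ab⊆ = ≡.subst (_⊆ XY) eq id

mainTheorem9 : (ℝ : RealNumbers) → let open SetFunctions ℝ in
    ∀ {n : ℕ} (N M : Subset n) (x y z : Fin n) →
    let L = M ─ ⁅ z ⁆ in
    let xy = ⁅ x ⁆ ∪ ⁅ y ⁆ in
    z ∈ M → L ⊂ N → N ─ L ≡ xy → x ≢ y →
    (r : SetFunction n) →
    let m = lowerRep N L z r in
    ( (𝓚 N m ⇔ (𝓚 M r × r ∅ ≤ r ⁅ z ⁆))
    × (𝓚 N m → ∀ a b C → ElementaryTriplet N a b C →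
    (Nonempty (xy ─ (⁅ a ⁆ ∪ ⁅ b ⁆ ∪ C)) →
    Indep m ⁅ a ⁆ ⁅ b ⁆ C ⇔ Indep r (⁅ a ⁆ ∩ L) (⁅ b ⁆ ∩ L) (C ∩ L))
    × (xy ⊆ C →
    Indep m ⁅ a ⁆ ⁅ b ⁆ C ⇔ Indep r ⁅ a ⁆ ⁅ b ⁆ (⁅ z ⁆ ∪ (C ∩ L)))
    × (∣ xy ∩ C ∣ ≡ 1 → xy ⊆ ⁅ a ⁆ ∪ ⁅ b ⁆ ∪ C →
    Indep m ⁅ a ⁆ ⁅ b ⁆ C ⇔ Indep r ⁅ z ⁆ ((⁅ a ⁆ ∪ ⁅ b ⁆) ∩ L) (C ∩ L))
    × (xy ≡ ⁅ a ⁆ ∪ ⁅ b ⁆ →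
    Indep m ⁅ a ⁆ ⁅ b ⁆ C ⇔ (r (⁅ z ⁆ ∪ C) ≈ r C))) )
    × ( (𝓚ℓ M r → 𝓚ℓ N m)
    × (𝓚ℓ M r → Extreme M r ⇔ Extreme N m) )
    × ( (Extreme M r → r ⁅ z ⁆ ≈ r ∅ →
    Extreme N m × QuantEquiv N m (lowerRep N L z (lowerStd r)))
    × (Extreme N m →
    (Extreme M r × r ⁅ z ⁆ ≈ r ∅)
    ⊎ (r ∅ < r ⁅ z ⁆ × 𝓛 M r ×
    QuantEquiv N m (λ S → (r ⁅ z ⁆ - r ∅) * indicator⊇ xy S))) )
mainTheorem9 ℝ N M x y z z∈M L⊂N N─L≡xy x≢y r =
  ( mk⇔ (rep-𝓚⁻ {r = r}) (λ (rK , r∅≤rZ) → rep-𝓚⁺ rK r∅≤rZ)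
  , λ _ a b C (a∈N , b∈N , a≢b , C⊆) →
    let open Triplet r a b C a∈N b∈N a≢b C⊆ in
    Indep-rep-outside r ⁅ a ⁆ ⁅ b ⁆ C , inside-case , half-case , pair-case ) ,
  ( rep-𝓚ℓ {r = r}
  , λ (_ , r∅≈0 , r⁅⁆≈0) →
    let jump≈0 = x≈y⇒x-y≈0 (trans (r⁅⁆≈0 z z∈M) (sym r∅≈0)) in
    mk⇔ (Extreme-rep⁺ {r = r} jump≈0) (Extreme-rep⁻ {r = r} jump≈0) ) ,
  ( (λ rE rZ≈r∅ → Extreme-rep⁺ {r = r} (x≈y⇒x-y≈0 rZ≈r∅) rE , rep-≈lowerStd {r = r} (x≈y⇒x-y≈0 rZ≈r∅))
  , λ mE → converse mE (jump r ≟ 0#) )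
  where
  open RealNumbers ℝ hiding (zero)
  open SetFunctions ℝ using (Extreme; 𝓛; QuantEquiv; indicator⊇; lowerRep)
  open OrderedField ℝ
  open SupermodularCone ℝ
  open Replication ℝ N M x y z z∈M (proj₁ L⊂N) N─L≡xy x≢y

  -- Supermodularity of the replication already excludes a negative jump, so a nonzero jump is
  -- positive.
  converse : Extreme N (rep r) → Dec (jump r ≈ 0#) →
    (Extreme M r × r ⁅ z ⁆ ≈ r ∅) ⊎
    (r ∅ < r ⁅ z ⁆ × 𝓛 M r ×
     QuantEquiv N (rep r) (λ S → (r ⁅ z ⁆ - r ∅) * indicator⊇ (⁅ x ⁆ ∪ ⁅ y ⁆) S))
  converse mE (yes jump≈0) = inj₁ (Extreme-rep⁻ {r = r} jump≈0 mE , x-y≈0⇒x≈y jump≈0)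
  converse mE (no jump≉0)  = inj₂
    ( (proj₂ (rep-𝓚⁻ {r = r} (proj₁ mE)) , λ r∅≈rZ → jump≉0 (x≈y⇒x-y≈0 (sym r∅≈rZ)))
    , rL , rep-𝓛≈indicator {r = r} rL )
    where
    rL : 𝓛 M r
    rL = rep-TightMaximal⇒𝓛 {r = r} jump≉0 (Extreme⇒TightMaximal {m = rep r} mE)
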